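{- Let $k$ be a fixed positive integer. For every $n$ and every reduced Latin square $L$ of order $n$ that has two distinct rows or two distinct columns whose relative cycle structure contains at most $k$ cycles, $$|\mathfrak{A}(L)|\le n^2(n-1)^k.$$ Moreover, on the set of all such Latin squares $L$, the autotopy group $\mathfrak{A}(L)$ can be computed in time polynomial in $n$.
   Context: A Latin square of order $n$ is an $n\times n$ array with entries in $[n]=\{1,\dots,n\}$ such that each row and each column is a permutation of $[n]$. It is reduced if its first row and first column are both the identity permutation. Row $i$ of $L$ is viewed as the permutation $\sigma_i\in S_n$ with $\sigma_i(j)=L(i,j)$, and column $j$ as the permutation $\pi_j\in S_n$ with $\pi_j(i)=L(i,j)$. Permutations are composed as functions, right to left. An isotopism is a triple $(\alpha,\beta,\gamma)\in S_n^3$, acting on Latin squares of order $n$ by permuting rows by $\alpha$, columns by $\beta$ and symbols by $\gamma$: $L'=(\alpha,\beta,\gamma)(L)$ is given by $L'(\alpha(i),\beta(j))=\gamma(L(i,j))$. The autotopy group $\mathfrak{A}(L)$ is the group of isotopisms $\Theta$ with $\Theta(L)=L$. The cycle structure of a permutation is the partition of $n$ given by the lengths of the cycles in its disjoint cycle decomposition (cycles of length 1 included). The relative cycle structure of rows $r$ and $s$ is the cycle structure of $\sigma_s\sigma_r^{ -1}$; similarly, the relative cycle structure of columns $r$ and $s$ is the cycle structure of $\pi_s\pi_r^{ -1}$. "Contains at most $k$ cycles" means that this permutation has at most $k$ cycles, counting those of length 1. "Computing $\mathfrak{A}(L)$" means: given $L$ as input, output the list of all its autotopisms; polynomial in $n$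 with $k$ fixed. -}

module Defs where

open import Algebra.Bundles using (Group)
open import Data.Fin.Base using (Fin; toℕ)
open import Data.Fin.Permutation as Perm
  using (Permutation′; _⟨$⟩ʳ_; _⟨$⟩ˡ_; flip; _∘ₚ_; inverseˡ; inverseʳ)
open import Data.List.Base using (List; []; _∷_; _∷ʳ_; length; map; concat; tabulate; allFin)
open import Data.List.Membership.Propositional using (_∈_)
open import Data.List.Relation.Binary.Permutation.Propositional using (_↭_)
open import Data.List.Relation.Unary.All as All using (All; []; _∷_)
import Data.List.Relation.Unary.Enumerates.Setoid as Enumerates
import Data.List.Relation.Unary.Unique.Setoid as UniqueSetoid
open import Data.Nat.Base using (ℕ; zero; suc; _+_; _*_; _^_; _≤_)
open import Data.Product.Base using (Σ; ∃-syntax; _×_; _,_; proj₁)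
open import Data.Sum.Base using (_⊎_; inj₁; inj₂)
open import Data.Unit.Base using (⊤; tt)
open import Data.Empty using (⊥)
open import Function.Bundles using (Inverse; mk⤖)
open import Function.Definitions using (Bijective)
open import Function.Properties.Bijection using (⤖⇒↔)
open import Level using (0ℓ)
open import Relation.Binary.Bundles using (Setoid)
open import Relation.Binary.PropositionalEquality
  using (_≡_; _≢_; refl; sym; trans; cong; cong₂; setoid)

------------------------------------------------------------------------
-- Latin squares

-- Rows, columns and symbols are indexed by Fin n, i.e. shifted to 0,…,n-1.

record LatinSquare (n : ℕ) : Set where
  field
    entry       : Fin n → Fin n → Fin n
    row-perm    : ∀ i → Bijective _≡_ _≡_ (λ j → entry i j)
    column-perm : ∀ j → Bijective _≡_ _≡_ (λ i → entry i j)

  row : Fin n → Permutation′ n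
  row i = ⤖⇒↔ (mk⤖ (row-perm i))

  column : Fin n → Permutation′ n
  column j = ⤖⇒↔ (mk⤖ (column-perm j))

open LatinSquare public

record Reduced {n : ℕ} (L : LatinSquare n) : Set where
  field
    first-row    : ∀ i j → toℕ i ≡ 0 → entry L i j ≡ j
    first-column : ∀ i j → toℕ j ≡ 0 → entry L i j ≡ i

------------------------------------------------------------------------
-- Cycle structure

-- The list (x₀ , … , x_{m-1}) is a cycle of π, as in (x₀ x₁ ⋯ x_{m-1}), when
-- π moves every x_t to x_{t+1} and x_{m-1} to x₀.  Fixed points are cycles of
-- length 1; distinctness of the xₜ comes from the decomposition below.

IsCycle : {n : ℕ} → Permutation′ n → List (Fin n) → Set
IsCycle π []       = ⊥
IsCycle π (x ∷ xs) = map (π ⟨$⟩ʳ_) (x ∷ xs) ≡ xs ∷ʳ x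

-- The last field says that each point lies on exactly one cycle, exactly once.

record CycleDecomposition {n : ℕ} (π : Permutation′ n) : Set where
  field
    cycles    : List (List (Fin n))
    areCycle  : All (IsCycle π) cycles
    partition : concat cycles ↭ allFin n

-- A partition of n is a list of its parts, in any order.

HasCycleStructure : {n : ℕ} → Permutation′ n → List ℕ → Set
HasCycleStructure π λs =
  Σ (CycleDecomposition π) λ D → map length (CycleDecomposition.cycles D) ↭ λs

HasAtMostCycles : {n : ℕ} → ℕ → Permutation′ n → Set
HasAtMostCycles k π = ∃[ λs ] HasCycleStructure π λs × length λs ≤ k

-- _∘ₚ_ composes from left to right, so these are σₛσᵣ⁻¹ and πₛπᵣ⁻¹.

relativeRow : {n : ℕ} → LatinSquare n → Fin n → Fin n → Permutation′ n
relativeRow L r s = flip (row L r) ∘ₚ row L s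

relativeColumn : {n : ℕ} → LatinSquare n → Fin n → Fin n → Permutation′ n
relativeColumn L r s = flip (column L r) ∘ₚ column L s

HasPairWithAtMostCycles : {n : ℕ} → ℕ → LatinSquare n → Set
HasPairWithAtMostCycles k L =
    (∃[ r ] ∃[ s ] r ≢ s × HasAtMostCycles k (relativeRow L r s))
  ⊎ (∃[ r ] ∃[ s ] r ≢ s × HasAtMostCycles k (relativeColumn L r s))

------------------------------------------------------------------------
-- The autotopy group

record Isotopism (n : ℕ) : Set where
  constructor isotopism
  field
    rows columns symbols : Permutation′ n

open Isotopism public

-- Θ Maps L To L′ says that L′ = Θ(L).

_Maps_To_ : {n : ℕ} → Isotopism n → LatinSquare n → LatinSquare n → Set
Θ Maps L To L′ = ∀ i j →
  entry L′ (rows Θ ⟨$⟩ʳ i) (columns Θ ⟨$⟩ʳ j) ≡ symbols Θ ⟨$⟩ʳ entry L i j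

Autotopism : {n : ℕ} → LatinSquare n → Set
Autotopism {n} L = Σ (Isotopism n) λ Θ → Θ Maps L To L

infix 4 _≈ᵢ_

record _≈ᵢ_ {n : ℕ} (Θ Φ : Isotopism n) : Set where
  constructor mk≈
  field
    rows≈    : rows Θ Perm.≈ rows Φ
    columns≈ : columns Θ Perm.≈ columns Φ
    symbols≈ : symbols Θ Perm.≈ symbols Φ

idᵢ : {n : ℕ} → Isotopism n
idᵢ = isotopism Perm.id Perm.id Perm.id

-- Θ ∘ᵢ Φ applies Φ first.

_∘ᵢ_ : {n : ℕ} → Isotopism n → Isotopism n → Isotopism n
Θ ∘ᵢ Φ = isotopism (rows Φ ∘ₚ rows Θ) (columns Φ ∘ₚ columns Θ) (symbols Φ ∘ₚ symbols Θ)

_⁻¹ᵢ : {n : ℕ} → Isotopism n → Isotopism n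
Θ ⁻¹ᵢ = isotopism (flip (rows Θ)) (flip (columns Θ)) (flip (symbols Θ))

private
  ∘ₚ-cong : {n : ℕ} (π π′ ρ ρ′ : Permutation′ n) →
            π Perm.≈ π′ → ρ Perm.≈ ρ′ → (π ∘ₚ ρ) Perm.≈ (π′ ∘ₚ ρ′)
  ∘ₚ-cong π π′ ρ ρ′ p q i = trans (cong (ρ ⟨$⟩ʳ_) (p i)) (q (π′ ⟨$⟩ʳ i))

  flip-cong : {n : ℕ} (π π′ : Permutation′ n) → π Perm.≈ π′ → flip π Perm.≈ flip π′
  flip-cong π π′ p i = trans (cong (π ⟨$⟩ˡ_) (sym (trans (p _) (inverseʳ π′)))) (inverseˡ π)

  ∘ᵢ-maps : {n : ℕ} (L : LatinSquare n) (Θ Φ : Isotopism n) →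
            Θ Maps L To L → Φ Maps L To L → (Θ ∘ᵢ Φ) Maps L To L
  ∘ᵢ-maps L Θ Φ p q i j = trans (p _ _) (cong (symbols Θ ⟨$⟩ʳ_) (q i j))

  ⁻¹ᵢ-maps : {n : ℕ} (L : LatinSquare n) (Θ : Isotopism n) →
             Θ Maps L To L → (Θ ⁻¹ᵢ) Maps L To L
  ⁻¹ᵢ-maps L Θ p i j = trans (sym (inverseˡ (symbols Θ)))
    (cong (symbols Θ ⟨$⟩ˡ_) (trans (sym (p _ _))
      (cong₂ (entry L) (inverseʳ (rows Θ)) (inverseʳ (columns Θ)))))

𝔄 : {n : ℕ} → LatinSquare n → Group 0ℓ 0ℓ
𝔄 L = record
  { Carrier = Autotopism L
  ; _≈_     = λ Θ Φ → proj₁ Θ ≈ᵢ proj₁ Φ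
  ; _∙_     = λ (Θ , p) (Φ , q) → Θ ∘ᵢ Φ , ∘ᵢ-maps L Θ Φ p q
  ; ε       = idᵢ , λ _ _ → refl
  ; _⁻¹     = λ (Θ , p) → Θ ⁻¹ᵢ , ⁻¹ᵢ-maps L Θ p
  ; isGroup = record
    { isMonoid = record
      { isSemigroup = record
        { isMagma = record
          { isEquivalence = record
            { refl  = mk≈ (λ _ → refl) (λ _ → refl) (λ _ → refl)
            ; sym   = λ (mk≈ a b c) → mk≈ (λ i → sym (a i)) (λ i → sym (b i)) (λ i → sym (c i))
            ; trans = λ (mk≈ a b c) (mk≈ a′ b′ c′) →
                mk≈ (λ i → trans (a i) (a′ i)) (λ i → trans (b i) (b′ i)) (λ i → trans (c i) (c′ i))
            }
          ; ∙-cong = λ {(Θ , _)} {(Θ′ , _)} {(Φ , _)} {(Φ′ , _)} (mk≈ a b c) (mk≈ a′ b′ c′) →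
              mk≈ (∘ₚ-cong (rows Φ) (rows Φ′) (rows Θ) (rows Θ′) a′ a)
                  (∘ₚ-cong (columns Φ) (columns Φ′) (columns Θ) (columns Θ′) b′ b)
                  (∘ₚ-cong (symbols Φ) (symbols Φ′) (symbols Θ) (symbols Θ′) c′ c)
          }
        ; assoc = λ _ _ _ → mk≈ (λ _ → refl) (λ _ → refl) (λ _ → refl)
        }
      ; identity = (λ _ → mk≈ (λ _ → refl) (λ _ → refl) (λ _ → refl))
                 , (λ _ → mk≈ (λ _ → refl) (λ _ → refl) (λ _ → refl))
      }
    ; inverse =
        (λ (Θ , _) → mk≈ (λ _ → inverseˡ (rows Θ)) (λ _ → inverseˡ (columns Θ)) (λ _ → inverseˡ (symbols Θ)))
      , (λ (Θ , _) → mk≈ (λ _ → inverseʳ (rows Θ)) (λ _ → inverseʳ (columns Θ)) (λ _ → inverseʳ (symbols Θ)))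
    ; ⁻¹-cong = λ {(Θ , _)} {(Φ , _)} (mk≈ a b c) →
        mk≈ (flip-cong (rows Θ) (rows Φ) a) (flip-cong (columns Θ) (columns Φ) b) (flip-cong (symbols Θ) (symbols Φ) c)
    }
  }

HasOrder : Group 0ℓ 0ℓ → ℕ → Set
HasOrder G m = Inverse (setoid (Fin m)) (Group.setoid G)

------------------------------------------------------------------------
-- A programming language with a step count

-- First-order expressions over finite data, with unbounded iteration.  Values
-- are immutable and shared and numbers are unary, so each evaluation rule is a
-- constant number of pointer operations for a fixed program.  In particular
-- there is no unit-cost arithmetic besides successor and predecessor, and
-- polynomially many steps here mean polynomial time in the usual sense (for
-- outputs whose size, written out without sharing, is polynomial as well).

infixr 5 _⊕_
infixr 6 _⊗_

data Ty : Set where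
  unit nat : Ty
  _⊕_ _⊗_  : Ty → Ty → Ty
  list     : Ty → Ty

⟦_⟧ : Ty → Set
⟦ unit ⟧   = ⊤
⟦ nat ⟧    = ℕ
⟦ A ⊕ B ⟧  = ⟦ A ⟧ ⊎ ⟦ B ⟧
⟦ A ⊗ B ⟧  = ⟦ A ⟧ × ⟦ B ⟧
⟦ list A ⟧ = List ⟦ A ⟧

Context : Set
Context = List Ty

Env : Context → Set
Env = All ⟦_⟧

private
  variable
    Γ     : Context
    A B C : Ty

data Term (Γ : Context) : Ty → Set where
  var       : A ∈ Γ → Term Γ A
  let-in    : Term Γ A → Term (A ∷ Γ) B → Term Γ B
  unit      : Term Γ unit
  pair      : Term Γ A → Term Γ B → Term Γ (A ⊗ B)
  fst       : Term Γ (A ⊗ B) → Term Γ A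
  snd       : Term Γ (A ⊗ B) → Term Γ B
  inl       : Term Γ A → Term Γ (A ⊕ B)
  inr       : Term Γ B → Term Γ (A ⊕ B)
  case-sum  : Term Γ (A ⊕ B) → Term (A ∷ Γ) C → Term (B ∷ Γ) C → Term Γ C
  zero      : Term Γ nat
  suc       : Term Γ nat → Term Γ nat
  case-nat  : Term Γ nat → Term Γ C → Term (nat ∷ Γ) C → Term Γ C
  nil       : Term Γ (list A)
  cons      : Term Γ A → Term Γ (list A) → Term Γ (list A)
  case-list : Term Γ (list A) → Term Γ C → Term (A ∷ list A ∷ Γ) C → Term Γ C
  -- loop t u starts from the value of t and repeats u on the current value
  -- until u returns on the right.
  loop      : Term Γ A → Term (A ∷ Γ) (A ⊕ B) → Term Γ B

infix 4 _⊢_⇓_⟨_⟩ _⊢_from_⇓_⟨_⟩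

-- ρ ⊢ t ⇓ v ⟨ n ⟩ : in environment ρ, t evaluates to v in n steps.

mutual
  data _⊢_⇓_⟨_⟩ (ρ : Env Γ) : Term Γ A → ⟦ A ⟧ → ℕ → Set where
    var : (x : A ∈ Γ) → ρ ⊢ var x ⇓ All.lookup ρ x ⟨ 1 ⟩
    let-in : ∀ {t : Term Γ A} {u : Term (A ∷ Γ) B} {v w m n} →
      ρ ⊢ t ⇓ v ⟨ m ⟩ → (v ∷ ρ) ⊢ u ⇓ w ⟨ n ⟩ →
      ρ ⊢ let-in t u ⇓ w ⟨ suc (m + n) ⟩
    unit : ρ ⊢ unit ⇓ tt ⟨ 1 ⟩
    pair : ∀ {t : Term Γ A} {u : Term Γ B} {v w m n} →
      ρ ⊢ t ⇓ v ⟨ m ⟩ → ρ ⊢ u ⇓ w ⟨ n ⟩ →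
      ρ ⊢ pair t u ⇓ (v , w) ⟨ suc (m + n) ⟩
    fst : ∀ {t : Term Γ (A ⊗ B)} {v w m} →
      ρ ⊢ t ⇓ (v , w) ⟨ m ⟩ → ρ ⊢ fst t ⇓ v ⟨ suc m ⟩
    snd : ∀ {t : Term Γ (A ⊗ B)} {v w m} →
      ρ ⊢ t ⇓ (v , w) ⟨ m ⟩ → ρ ⊢ snd t ⇓ w ⟨ suc m ⟩
    inl : ∀ {t : Term Γ A} {v m} →
      ρ ⊢ t ⇓ v ⟨ m ⟩ → ρ ⊢ inl {B = B} t ⇓ inj₁ v ⟨ suc m ⟩
    inr : ∀ {t : Term Γ B} {v m} →
      ρ ⊢ t ⇓ v ⟨ m ⟩ → ρ ⊢ inr {A = A} t ⇓ inj₂ v ⟨ suc m ⟩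
    case-inl : ∀ {t : Term Γ (A ⊕ B)} {l : Term (A ∷ Γ) C} {r v w m n} →
      ρ ⊢ t ⇓ inj₁ v ⟨ m ⟩ → (v ∷ ρ) ⊢ l ⇓ w ⟨ n ⟩ →
      ρ ⊢ case-sum t l r ⇓ w ⟨ suc (m + n) ⟩
    case-inr : ∀ {t : Term Γ (A ⊕ B)} {l} {r : Term (B ∷ Γ) C} {v w m n} →
      ρ ⊢ t ⇓ inj₂ v ⟨ m ⟩ → (v ∷ ρ) ⊢ r ⇓ w ⟨ n ⟩ →
      ρ ⊢ case-sum t l r ⇓ w ⟨ suc (m + n) ⟩
    zero : ρ ⊢ zero ⇓ 0 ⟨ 1 ⟩
    suc : ∀ {t : Term Γ nat} {v m} →
      ρ ⊢ t ⇓ v ⟨ m ⟩ → ρ ⊢ suc t ⇓ suc v ⟨ suc m ⟩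
    case-zero : ∀ {t : Term Γ nat} {z : Term Γ C} {s w m n} →
      ρ ⊢ t ⇓ 0 ⟨ m ⟩ → ρ ⊢ z ⇓ w ⟨ n ⟩ →
      ρ ⊢ case-nat t z s ⇓ w ⟨ suc (m + n) ⟩
    case-suc : ∀ {t : Term Γ nat} {z : Term Γ C} {s v w m n} →
      ρ ⊢ t ⇓ suc v ⟨ m ⟩ → (v ∷ ρ) ⊢ s ⇓ w ⟨ n ⟩ →
      ρ ⊢ case-nat t z s ⇓ w ⟨ suc (m + n) ⟩
    nil : ρ ⊢ nil {A = A} ⇓ [] ⟨ 1 ⟩
    cons : ∀ {t : Term Γ A} {u : Term Γ (list A)} {v vs m n} →
      ρ ⊢ t ⇓ v ⟨ m ⟩ → ρ ⊢ u ⇓ vs ⟨ n ⟩ →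
      ρ ⊢ cons t u ⇓ v ∷ vs ⟨ suc (m + n) ⟩
    case-nil : ∀ {t : Term Γ (list A)} {z : Term Γ C} {s w m n} →
      ρ ⊢ t ⇓ [] ⟨ m ⟩ → ρ ⊢ z ⇓ w ⟨ n ⟩ →
      ρ ⊢ case-list t z s ⇓ w ⟨ suc (m + n) ⟩
    case-cons : ∀ {t : Term Γ (list A)} {z : Term Γ C} {s v vs w m n} →
      ρ ⊢ t ⇓ v ∷ vs ⟨ m ⟩ → (v ∷ vs ∷ ρ) ⊢ s ⇓ w ⟨ n ⟩ →
      ρ ⊢ case-list t z s ⇓ w ⟨ suc (m + n) ⟩
    loop : ∀ {t : Term Γ A} {u : Term (A ∷ Γ) (A ⊕ B)} {v w m n} →
      ρ ⊢ t ⇓ v ⟨ m ⟩ → ρ ⊢ u from v ⇓ w ⟨ n ⟩ →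
      ρ ⊢ loop t u ⇓ w ⟨ suc (m + n) ⟩

  data _⊢_from_⇓_⟨_⟩ (ρ : Env Γ) (u : Term (A ∷ Γ) (A ⊕ B)) : ⟦ A ⟧ → ⟦ B ⟧ → ℕ → Set where
    stop : ∀ {v w m} →
      (v ∷ ρ) ⊢ u ⇓ inj₂ w ⟨ m ⟩ → ρ ⊢ u from v ⇓ w ⟨ suc m ⟩
    next : ∀ {v v′ w m n} →
      (v ∷ ρ) ⊢ u ⇓ inj₁ v′ ⟨ m ⟩ → ρ ⊢ u from v′ ⇓ w ⟨ n ⟩ →
      ρ ⊢ u from v ⇓ w ⟨ suc (m + n) ⟩

Program : Ty → Ty → Set
Program A B = Term (A ∷ []) B

_On_Returns_In_Steps : Program A B → ⟦ A ⟧ → ⟦ B ⟧ → ℕ → Set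
P On x Returns y In m Steps = (x ∷ []) ⊢ P ⇓ y ⟨ m ⟩

------------------------------------------------------------------------
-- Computing the autotopy group

-- A square is given by the list of its rows, and a permutation π of Fin n by
-- the list π(0), …, π(n-1).

squareTy permTy isotopismTy : Ty
squareTy    = list (list nat)
permTy      = list nat
isotopismTy = permTy ⊗ permTy ⊗ permTy

encodeSquare : {n : ℕ} → LatinSquare n → ⟦ squareTy ⟧
encodeSquare L = tabulate λ i → tabulate λ j → toℕ (entry L i j)

encodePerm : {n : ℕ} → Permutation′ n → ⟦ permTy ⟧
encodePerm π = tabulate λ i → toℕ (π ⟨$⟩ʳ i)

encodeIsotopism : {n : ℕ} → Isotopism n → ⟦ isotopismTy ⟧
encodeIsotopism Θ = encodePerm (rows Θ) , encodePerm (columns Θ) , encodePerm (symbols Θ)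

-- Every autotopism of L is listed exactly once, in an unspecified order.

IsListOfAutotopisms : {n : ℕ} → LatinSquare n → ⟦ list isotopismTy ⟧ → Set
IsListOfAutotopisms L out = Σ (List (Autotopism L)) λ Θs →
    Enumerates.IsEnumeration (Group.setoid (𝔄 L)) Θs
  × UniqueSetoid.Unique (Group.setoid (𝔄 L)) Θs
  × out ≡ map (λ Θ → encodeIsotopism (proj₁ Θ)) Θs

-- A single program, and a single polynomial bound c·n^d + c, serve every order
-- n and every square of that order satisfying Q.

AutotopyGroupComputableInPolynomialTimeOn : (∀ {n} → LatinSquare n → Set) → Set
AutotopyGroupComputableInPolynomialTimeOn Q =
  Σ (Program squareTy (list isotopismTy)) λ P →
  ∃[ c ] ∃[ d ] ∀ (n : ℕ) (L : LatinSquare n) → Q L →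
  ∃[ out ] ∃[ steps ]
      P On encodeSquare L Returns out In steps Steps
    × IsListOfAutotopisms L out
    × steps ≤ c * n ^ d + c

{-# OPTIONS --safe #-}
module Submission where

-- An autotopism (α, β, γ) satisfies γ σᵢ = σ_{α(i)} β for every row i, so it
-- conjugates π = σₛσᵣ⁻¹ to σ_{α(s)}σ_{α(r)}⁻¹ by γ.  Hence α(r), α(s) and the
-- images under γ of one symbol on each cycle of π determine γ, then
-- β = σ_{α(r)}⁻¹ γ σᵣ, and then α, since the rows of L are distinct.  There are
-- n(n-1) choices for α(r) ≠ α(s), n for the image of the first symbol, and n-1
-- for each of the others, which differ from the first.  Columns are the rows of
-- the transposed square.
--
-- The program need not find r, s or the cycles: it reconstructs a candidate from
-- every assignment of images to 2+k indices, for L and for its transpose, keeps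
-- those that are autotopisms, and removes repetitions.

open import Defs
open import Algebra.Bundles using (Group)
open import Data.Bool.Base using (Bool; true; false; if_then_else_; _∧_; _∨_; not)
open import Data.Fin.Base using (Fin; zero; suc; toℕ; punchOut; combine; funToFin; finToFun)
import Data.Fin.Properties as Fin
open import Data.Fin.Permutation as Perm
  using (Permutation′; permutation; _⟨$⟩ʳ_; _⟨$⟩ˡ_; inverseˡ; inverseʳ)
open import Data.List.Base
open import Data.List.Properties
open import Data.List.Membership.Propositional using (_∈_)
open import Data.List.Membership.Propositional.Properties
open import Data.List.Relation.Binary.Permutation.Propositional using (↭-sym; ↭⇒↭ₛ)
open import Data.List.Relation.Binary.Permutation.Propositional.Properties using (↭-length; ∈-resp-↭)
import Data.List.Relation.Binary.Permutation.Setoid.Properties as Permutationₛ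
open import Data.List.Relation.Unary.All as All using (All; []; _∷_)
import Data.List.Relation.Unary.All.Properties as All
open import Data.List.Relation.Unary.AllPairs using ([]; _∷_)
open import Data.List.Relation.Unary.Any as Any using (Any; here; there)
import Data.List.Relation.Unary.Any.Properties as Any
import Data.List.Relation.Unary.Enumerates.Setoid as Enumerates
import Data.List.Relation.Unary.Unique.DecPropositional.Properties as Deduplicate
open import Data.List.Relation.Unary.Unique.Propositional using () renaming (Unique to Uniqueₚ)
import Data.List.Relation.Unary.Unique.Propositional.Properties as Uniqueₚ
import Data.List.Relation.Unary.Unique.Setoid as UniqueSetoid
import Data.List.Relation.Unary.Unique.Setoid.Properties as Unique
open import Data.Nat.Base
open import Data.Nat.Properties
open import Data.List.Membership.DecPropositional _≟_ using (_∈?_)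
open import Data.Product.Base using (∃-syntax; _×_; _,_; proj₁; proj₂; uncurry)
import Data.Product.Properties as Product
open import Data.Sum.Base using (_⊎_; inj₁; inj₂; [_,_]′)
open import Data.Unit.Base using (⊤; tt)
import Data.Unit.Properties as Unit
open import Function.Base using (_∘_; id)
open import Function.Bundles using (Inverse; mk⇔)
open import Function.Definitions using (Injective)
open import Level using (0ℓ)
open import Relation.Binary.Bundles using (Setoid)
open import Relation.Binary.Definitions using (DecidableEquality)
open import Relation.Binary.PropositionalEquality
open import Relation.Nullary using (yes; no; contradiction)
open import Relation.Nullary.Decidable using (does; ¬?; _×-dec_; does-⇔; dec-true; dec-false)
open import Relation.Unary using (Decidable)

-- Both halves rest on `candidate-correct`: the program's own `candidate`, fed the values of an
-- autotopism at r, s and one symbol per cycle, returns the encoding of that autotopism. Hence the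
-- search misses nothing, and autotopisms with equal seeds coincide, which gives the bound. The
-- order is the length of the output list.
--
-- A seed is a pair (index, image) instead of an image alone. Guessing r, s and the symbols together
-- with their images then costs only a larger exponent: there are n^(2(2+k)) tuples, polynomially
-- many because k is fixed. A wrong guess may produce anything, even contradictory tables, so every
-- function is total with default values and the final test is a complete check.
--
-- The obstacle on the computational side is that time bounds alone do not compose: a program may
-- run on the output of another, and a loop on its own accumulator. A step bound is therefore always
-- carried along with a bound on the size of the result, and terms, step bounds and size bounds are
-- assembled together by combinators.

private
  variable
    A B C X : Ty
    Γ       : Context

-- Polynomial time functions

-- Numbers are unary and count with their value; every list cell counts 1, so that the size also
-- dominates the length.
size : ∀ A → ⟦ A ⟧ → ℕ
size unit     _        = 0
size nat      n        = n
size (A ⊕ B)  (inj₁ x) = size A x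
size (A ⊕ B)  (inj₂ y) = size B y
size (A ⊗ B)  (x , y)  = size A x + size B y
size (list A) []       = 0
size (list A) (x ∷ xs) = suc (size A x + size (list A) xs)

infixl 6 _⊞_
infixl 7 _⊠_
infixr 9 _⊡_

-- Bounds are kept as syntax so that a degree can be read off at the end. Coefficients are naturals,
-- which makes every bound monotone: an upper estimate of a size may always be substituted. `_⊡_` is
-- composition.
data Poly : Set where
  con             : ℕ → Poly
  var             : Poly
  _⊞_ _⊠_ _⊡_ : Poly → Poly → Poly

eval : Poly → ℕ → ℕ
eval (con c) n = c
eval var     n = n
eval (p ⊞ q) n = eval p n + eval q n
eval (p ⊠ q) n = eval p n * eval q n
eval (p ⊡ q) n = eval p (eval q n)

eval-mono : ∀ p {m n} → m ≤ n → eval p m ≤ eval p n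
eval-mono (con c) m≤n = ≤-refl
eval-mono var     m≤n = m≤n
eval-mono (p ⊞ q) m≤n = +-mono-≤ (eval-mono p m≤n) (eval-mono q m≤n)
eval-mono (p ⊠ q) m≤n = *-mono-≤ (eval-mono p m≤n) (eval-mono q m≤n)
eval-mono (p ⊡ q) m≤n = eval-mono p (eval-mono q m≤n)

-- The code is polymorphic in the context, so that it can be placed under binders
-- without a weakening lemma.
record PolyTime {A B : Ty} (f : ⟦ A ⟧ → ⟦ B ⟧) : Set where
  field
    code       : Term (A ∷ Γ) B
    time space : Poly
    run        : (ρ : Env Γ) (x : ⟦ A ⟧) →
                 ∃[ m ] (x ∷ ρ) ⊢ code ⇓ f x ⟨ m ⟩ × m ≤ eval time (size A x)
    small      : ∀ x → size B (f x) ≤ eval space (size A x)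

open PolyTime

-- Pointwise equality cannot be turned into equality of functions, so this transport links what the
-- code literally computes to the list function that it is meant to compute.
PolyTime-≗ : {f g : ⟦ A ⟧ → ⟦ B ⟧} → (∀ x → f x ≡ g x) → PolyTime {A} {B} f → PolyTime {A} {B} g
PolyTime-≗ {A} {B} {f} f≗g p = record
  { code  = code p
  ; time  = time p
  ; space = space p
  ; run   = λ ρ x → subst (λ y → ∃[ m ] (x ∷ ρ) ⊢ code p ⇓ y ⟨ m ⟩ × m ≤ eval (time p) (size A x))
      (f≗g x) (run p ρ x)
  ; small = λ x → subst (λ y → size B y ≤ eval (space p) (size A x)) (f≗g x) (small p x)
  }

v₀ : Term (A ∷ Γ) A
v₀ = var (here refl)

v₁ : Term (A ∷ B ∷ Γ) B
v₁ = var (there (here refl))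

v₂ : Term (A ∷ B ∷ C ∷ Γ) C
v₂ = var (there (there (here refl)))

idᵖ : PolyTime {A} {A} id
idᵖ = record
  { code  = v₀
  ; time  = con 1
  ; space = var
  ; run   = λ ρ x → 1 , var _ , ≤-refl
  ; small = λ x → ≤-refl
  }

fstᵖ : PolyTime {A ⊗ B} {A} proj₁
fstᵖ = record
  { code  = fst v₀
  ; time  = con 2
  ; space = var
  ; run   = λ ρ x → 2 , fst (var _) , ≤-refl
  ; small = λ x → m≤m+n _ _
  }

sndᵖ : PolyTime {A ⊗ B} {B} proj₂
sndᵖ {A} = record
  { code  = snd v₀
  ; time  = con 2
  ; space = var
  ; run   = λ ρ x → 2 , snd (var _) , ≤-refl
  ; small = λ x → m≤n+m _ (size A (proj₁ x))
  }

infixr 9 _∘ᵖ_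

_∘ᵖ_ : {g : ⟦ B ⟧ → ⟦ C ⟧} {f : ⟦ A ⟧ → ⟦ B ⟧} →
       PolyTime {B} {C} g → PolyTime {A} {B} f → PolyTime {A} {C} (λ x → g (f x))
_∘ᵖ_ {f = f} q p = record
  { code  = let-in (code p) (code q)
  ; time  = con 1 ⊞ (time p ⊞ time q ⊡ space p)
  ; space = space q ⊡ space p
  ; run   = λ ρ x →
      let m , d , m≤ = run p ρ x
          n , e , n≤ = run q (x ∷ ρ) (f x)
      in _ , let-in d e , s≤s (+-mono-≤ m≤ (≤-trans n≤ (eval-mono (time q) (small p x))))
  ; small = λ x → ≤-trans (small q _) (eval-mono (space q) (small p x))
  }

⟨_,_⟩ : {f : ⟦ A ⟧ → ⟦ B ⟧} {g : ⟦ A ⟧ → ⟦ C ⟧} →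
        PolyTime {A} {B} f → PolyTime {A} {C} g → PolyTime {A} {B ⊗ C} (λ x → f x , g x)
⟨ p , q ⟩ = record
  { code  = pair (code p) (code q)
  ; time  = con 1 ⊞ (time p ⊞ time q)
  ; space = space p ⊞ space q
  ; run   = λ ρ x →
      let m , d , m≤ = run p ρ x
          n , e , n≤ = run q ρ x
      in _ , pair d e , s≤s (+-mono-≤ m≤ n≤)
  ; small = λ x → +-mono-≤ (small p x) (small q x)
  }

ttᵖ : PolyTime {A} {unit} (λ _ → tt)
ttᵖ = record
  { code = unit ; time = con 1 ; space = con 0
  ; run = λ _ _ → 1 , unit , ≤-refl ; small = λ _ → ≤-refl }

zeroᵖ : PolyTime {A} {nat} (λ _ → 0)
zeroᵖ = record
  { code = zero ; time = con 1 ; space = con 0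
  ; run = λ _ _ → 1 , zero , ≤-refl ; small = λ _ → ≤-refl }

sucᵖ : PolyTime {nat} {nat} suc
sucᵖ = record
  { code = suc v₀ ; time = con 2 ; space = con 1 ⊞ var
  ; run = λ _ _ → 2 , suc (var _) , ≤-refl ; small = λ _ → ≤-refl }

inlᵖ : PolyTime {A} {A ⊕ B} inj₁
inlᵖ = record
  { code = inl v₀ ; time = con 2 ; space = var
  ; run = λ _ _ → 2 , inl (var _) , ≤-refl ; small = λ _ → ≤-refl }

inrᵖ : PolyTime {B} {A ⊕ B} inj₂
inrᵖ = record
  { code = inr v₀ ; time = con 2 ; space = var
  ; run = λ _ _ → 2 , inr (var _) , ≤-refl ; small = λ _ → ≤-refl }

nilᵖ : PolyTime {A} {list B} (λ _ → [])
nilᵖ = record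
  { code = nil ; time = con 1 ; space = con 0
  ; run = λ _ _ → 1 , nil , ≤-refl ; small = λ _ → ≤-refl }

consᵖ : PolyTime {A ⊗ list A} {list A} (λ (x , xs) → x ∷ xs)
consᵖ = record
  { code = cons (fst v₀) (snd v₀) ; time = con 5 ; space = con 1 ⊞ var
  ; run = λ _ _ → 5 , cons (fst (var _)) (snd (var _)) , ≤-refl ; small = λ _ → ≤-refl }

uncons′ : {A : Set} → List A → ⊤ ⊎ (A × List A)
uncons′ []       = inj₁ tt
uncons′ (x ∷ xs) = inj₂ (x , xs)

unconsᵖ : PolyTime {list A} {unit ⊕ (A ⊗ list A)} uncons′
unconsᵖ = record
  { code  = case-list v₀ (inl unit) (inr (pair v₀ v₁))
  ; time  = con 6
  ; space = var
  ; run   = λ where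
      ρ []       → _ , case-nil (var _) (inl unit) , s≤s (s≤s (s≤s (s≤s z≤n)))
      ρ (x ∷ xs) → _ , case-cons (var _) (inr (pair (var _) (var _))) , ≤-refl
  ; small = λ where
      []       → z≤n
      (x ∷ xs) → n≤1+n _
  }

-- `Poly` has no maximum, so the bounds of the two branches are added. Each branch first pairs the
-- input with the injected value, which accounts for the 4 steps.
caseᵖ : {f : ⟦ X ⟧ → ⟦ A ⊕ B ⟧} {g : ⟦ X ⊗ A ⟧ → ⟦ C ⟧} {h : ⟦ X ⊗ B ⟧ → ⟦ C ⟧} →
        PolyTime {X} {A ⊕ B} f → PolyTime {X ⊗ A} {C} g → PolyTime {X ⊗ B} {C} h →
        PolyTime {X} {C} (λ x → [ (λ a → g (x , a)) , (λ b → h (x , b)) ]′ (f x))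
caseᵖ {X} {A} {B} {C} {f} {g} {h} p q r = record
  { code  = case-sum (code p) (let-in (pair v₁ v₀) (code q)) (let-in (pair v₁ v₀) (code r))
  ; time  = con 1 ⊞ (time p ⊞ (con 4 ⊞ (time q ⊞ time r) ⊡ (var ⊞ space p)))
  ; space = (space q ⊞ space r) ⊡ (var ⊞ space p)
  ; run   = run′
  ; small = small′
  }
  where
  arg : ⟦ X ⟧ → ℕ
  arg x = size X x + eval (space p) (size X x)

  branch : ⟦ X ⟧ → ⟦ A ⊕ B ⟧ → ⟦ C ⟧
  branch x = [ (λ a → g (x , a)) , (λ b → h (x , b)) ]′

  run′ : (ρ : Env Γ) (x : ⟦ X ⟧) → ∃[ m ]
    (x ∷ ρ) ⊢ case-sum (code p) (let-in (pair v₁ v₀) (code q)) (let-in (pair v₁ v₀) (code r))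
      ⇓ branch x (f x) ⟨ m ⟩
    × m ≤ suc (eval (time p) (size X x) + (4 + (eval (time q) (arg x) + eval (time r) (arg x))))
  run′ ρ x with f x | run p ρ x | small p x
  ... | inj₁ a | m , d , m≤ | a≤ =
    let n , e , n≤ = run q (a ∷ x ∷ ρ) (x , a)
    in _ , case-inl d (let-in (pair (var _) (var _)) e)
     , s≤s (+-mono-≤ m≤ (+-monoʳ-≤ 4 (≤-trans n≤ (≤-trans
         (eval-mono (time q) (+-monoʳ-≤ (size X x) a≤)) (m≤m+n _ (eval (time r) (arg x)))))))
  ... | inj₂ b | m , d , m≤ | b≤ =
    let n , e , n≤ = run r (b ∷ x ∷ ρ) (x , b)
    in _ , case-inr d (let-in (pair (var _) (var _)) e)
     , s≤s (+-mono-≤ m≤ (+-monoʳ-≤ 4 (≤-trans n≤ (≤-trans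
         (eval-mono (time r) (+-monoʳ-≤ (size X x) b≤)) (m≤n+m _ (eval (time q) (arg x)))))))

  small′ : ∀ x → size C (branch x (f x)) ≤ eval (space q) (arg x) + eval (space r) (arg x)
  small′ x with f x | small p x
  ... | inj₁ a | a≤ = ≤-trans (small q (x , a)) (≤-trans
         (eval-mono (space q) (+-monoʳ-≤ (size X x) a≤)) (m≤m+n _ (eval (space r) (arg x))))
  ... | inj₂ b | b≤ = ≤-trans (small r (x , b)) (≤-trans
         (eval-mono (space r) (+-monoʳ-≤ (size X x) b≤)) (m≤n+m _ (eval (space q) (arg x))))

-- Loops and folds

tick : ℕ → List ⊤ → List ⊤
tick zero    us = us
tick (suc n) us = tick n (tt ∷ us)

length-tick : ∀ n us → length (tick n us) ≡ n + length us
length-tick zero    us = refl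
length-tick (suc n) us = trans (length-tick n (tt ∷ us)) (+-suc n (length us))

replicate-length : ∀ us → us ≡ replicate (length us) tt
replicate-length []       = refl
replicate-length (u ∷ us) = cong (tt ∷_) (replicate-length us)

tick≗replicate : ∀ n → tick n [] ≡ replicate n tt
tick≗replicate n = trans (replicate-length (tick n []))
  (cong (λ m → replicate m tt) (trans (length-tick n []) (+-identityʳ n)))

size-units : ∀ us → size (list unit) us ≡ length us
size-units []       = refl
size-units (u ∷ us) = cong suc (size-units us)

-- Once a number is a list of units, recursion on numbers reduces to folds over lists; this is the
-- only loop that counts down a number.
unitsᵖ : PolyTime {nat} {list unit} (λ n → replicate n tt)
unitsᵖ = PolyTime-≗ tick≗replicate record
  { code  = loop (pair v₀ nil) body
  -- Starting the loop takes 4 steps, each round 11, and the last round 7.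
  ; time  = con 4 ⊞ (con 1 ⊞ var) ⊠ con 11
  ; space = var
  ; run   = λ ρ n → let m , d , m≤ = iterate′ (n ∷ ρ) n [] in _ , loop (pair (var _) nil) d , +-monoʳ-≤ 4 m≤
  ; small = λ n → ≤-reflexive (trans (size-units (tick n [])) (trans (length-tick n []) (+-identityʳ n)))
  }
  where
  body : Term (nat ⊗ list unit ∷ Γ) ((nat ⊗ list unit) ⊕ list unit)
  body = case-nat (fst v₀) (inr (snd v₀)) (inl (pair v₀ (cons unit (snd v₁))))

  iterate′ : (ρ : Env Γ) → ∀ n us → ∃[ m ] ρ ⊢ body from (n , us) ⇓ tick n us ⟨ m ⟩ × m ≤ suc n * 11
  iterate′ ρ zero    us = _ , stop (case-zero (fst (var _)) (inr (snd (var _)))) , m≤m+n 7 4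
  iterate′ ρ (suc n) us =
    let m , d , m≤ = iterate′ ρ n (tt ∷ us)
    in _ , next (case-suc (fst (var _)) (inl (pair (var _) (cons unit (snd (var _)))))) d , +-monoʳ-≤ 11 m≤

size≥length : ∀ (xs : ⟦ list A ⟧) → length xs ≤ size (list A) xs
size≥length     []       = z≤n
size≥length {A} (x ∷ xs) = s≤s (≤-trans (size≥length xs) (m≤n+m _ (size A x)))

-- A loop runs in polynomial time only if its accumulator stays polynomially
-- small, hence the hypothesis on the result; applied to the initial segments of
-- the list it bounds every intermediate accumulator.
foldlᵖ : {i : ⟦ X ⟧ → ⟦ B ⟧} {f : ⟦ X ⊗ (B ⊗ A) ⟧ → ⟦ B ⟧} →
         PolyTime {X} {B} i → PolyTime {X ⊗ (B ⊗ A)} {B} f → (q : Poly) →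
         (∀ x as → size B (foldl (λ b a → f (x , b , a)) (i x) as) ≤ eval q (size X x + size (list A) as)) →
         PolyTime {X ⊗ list A} {B} (λ (x , as) → foldl (λ b a → f (x , b , a)) (i x) as)
foldlᵖ {X} {B} {A} {i} {f} p r q bounded = record
  { code  = loop (pair (fst v₀) (pair (let-in (fst v₀) (code p)) (snd v₀))) body
  ; time  = con 1 ⊞ ((con 9 ⊞ time p) ⊞ (con 1 ⊞ var) ⊠ (con 20 ⊞ time r ⊡ (var ⊞ q)))
  ; space = q
  ; run   = λ ρ (x , as) →
      let m , d , m≤ = run p ((x , as) ∷ ρ) x
          s = size X x + size (list A) as
          n , e , n≤ = iterate′ ((x , as) ∷ ρ) x s (eval q s) as (i x)
                         (prefixes-bounded x as) ≤-refl
      in _ , loop (pair (fst (var _)) (pair (let-in (fst (var _)) d) (snd (var _)))) e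
       , s≤s (+-mono-≤ (start m (≤-trans m≤ (eval-mono (time p) (m≤m+n _ _))))
           (≤-trans n≤ (*-monoˡ-≤ (20 + eval (time r) (s + eval q s)) (s≤s (≤-trans (size≥length as) (m≤n+m _ (size X x)))))))
  ; small = λ (x , as) → bounded x as
  }
  where
  body : Term (X ⊗ B ⊗ list A ∷ Γ) ((X ⊗ B ⊗ list A) ⊕ B)
  body = case-list (snd (snd v₀)) (inr (fst (snd v₀)))
    (inl (pair (fst v₂) (pair (let-in (pair (fst v₂) (pair (fst (snd v₂)) v₀)) (code r)) v₁)))

  start : ∀ m {t} → m ≤ t → suc (2 + suc (suc (2 + m) + 2)) ≤ 9 + t
  start m m≤t = +-monoʳ-≤ 7 (≤-trans (≤-reflexive (+-comm m 2)) (+-monoʳ-≤ 2 m≤t))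

  size-++ˡ : ∀ ys zs → size (list A) ys ≤ size (list A) (ys ++ zs)
  size-++ˡ []       zs = z≤n
  size-++ˡ (y ∷ ys) zs = s≤s (+-monoʳ-≤ (size A y) (size-++ˡ ys zs))

  prefixes-bounded : ∀ x as ys zs → ys ++ zs ≡ as →
    size B (foldl (λ b a → f (x , b , a)) (i x) ys) ≤ eval q (size X x + size (list A) as)
  prefixes-bounded x _ ys zs refl = ≤-trans (bounded x ys)
    (eval-mono q (+-monoʳ-≤ (size X x) (size-++ˡ ys zs)))

  -- N and K stay fixed throughout the loop: N bounds the parameter together with the remaining
  -- list, K every accumulator still to come. A round then costs at most 20 steps plus the time of
  -- the body on an argument of size N + K.
  iterate′ : (ρ : Env Γ) (x : ⟦ X ⟧) (N K : ℕ) (as : ⟦ list A ⟧) (b : ⟦ B ⟧) →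
             (∀ ys zs → ys ++ zs ≡ as → size B (foldl (λ b a → f (x , b , a)) b ys) ≤ K) →
             size X x + size (list A) as ≤ N →
             ∃[ m ] ρ ⊢ body from (x , b , as) ⇓ foldl (λ b a → f (x , b , a)) b as ⟨ m ⟩
               × m ≤ suc (length as) * (20 + eval (time r) (N + K))
  iterate′ ρ x N K [] b prefixes x≤N =
    _ , stop (case-nil (snd (snd (var _))) (inr (fst (snd (var _)))))
      , m≤m+n 9 _
  iterate′ ρ x N K (a ∷ as) b prefixes x≤N =
    let m , d , m≤ = run r (a ∷ as ∷ (x , b , a ∷ as) ∷ ρ) (x , b , a)
        n , e , n≤ = iterate′ ρ x N K as (f (x , b , a))
                       (λ ys zs eq → prefixes (a ∷ ys) zs (cong (a ∷_) eq))
                       (≤-trans (+-monoʳ-≤ (size X x) (m≤n⇒m≤1+n (m≤n+m _ (size A a)))) x≤N)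
    in _ , next (case-cons (snd (snd (var _)))
             (inl (pair (fst (var _)) (pair (let-in (pair (fst (var _)) (pair (fst (snd (var _))) (var _))) d) (var _))))) e
         , +-mono-≤ (+-monoʳ-≤ 19 (≤-trans
             (≤-reflexive (+-comm m 1)) (s≤s (≤-trans m≤ (eval-mono (time r) arg≤))))) n≤
    where
    open ≤-Reasoning
    arg≤ : size X x + (size B b + size A a) ≤ N + K
    arg≤ = begin
      size X x + (size B b + size A a)  ≡⟨ cong (size X x +_) (+-comm (size B b) (size A a)) ⟩
      size X x + (size A a + size B b)  ≡⟨ +-assoc (size X x) (size A a) (size B b) ⟨
      size X x + size A a + size B b
          ≤⟨ +-mono-≤ (≤-trans (+-monoʳ-≤ (size X x) (m≤n⇒m≤1+n (m≤m+n _ _))) x≤N) (prefixes [] (a ∷ as) refl) ⟩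
      N + K ∎

size-reverseAcc : ∀ (acc as : ⟦ list A ⟧) →
                  size (list A) (reverseAcc acc as) ≡ size (list A) as + size (list A) acc
size-reverseAcc     acc []       = refl
size-reverseAcc {A} acc (a ∷ as) = begin
  size (list A) (reverseAcc (a ∷ acc) as)                              ≡⟨ size-reverseAcc (a ∷ acc) as ⟩
  size (list A) as + suc (size A a + size (list A) acc)                ≡⟨ +-suc (size (list A) as) _ ⟩
  suc (size (list A) as + (size A a + size (list A) acc))
      ≡⟨ cong suc (+-assoc (size (list A) as) (size A a) _) ⟨
  suc (size (list A) as + size A a + size (list A) acc)
      ≡⟨ cong (λ m → suc (m + size (list A) acc)) (+-comm (size (list A) as) (size A a)) ⟩
  suc (size A a + size (list A) as + size (list A) acc)                ∎
  where open ≡-Reasoning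

size-reverse : ∀ (as : ⟦ list A ⟧) → size (list A) (reverse as) ≡ size (list A) as
size-reverse as = trans (size-reverseAcc [] as) (+-identityʳ _)

reverseᵖ : PolyTime {list A} {list A} reverse
reverseᵖ = foldlᵖ {X = unit} nilᵖ (consᵖ ∘ᵖ ⟨ sndᵖ ∘ᵖ sndᵖ , fstᵖ ∘ᵖ sndᵖ ⟩) var
             (λ _ as → ≤-reflexive (size-reverse as))
           ∘ᵖ ⟨ ttᵖ , idᵖ ⟩

-- A loop consumes its list from the front, so the right fold is run as a left fold over the
-- reversed list, which has the same size.
foldrᵖ : {i : ⟦ X ⟧ → ⟦ B ⟧} {as : ⟦ X ⟧ → ⟦ list A ⟧} {f : ⟦ X ⊗ (B ⊗ A) ⟧ → ⟦ B ⟧} →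
         PolyTime {X} {B} i → PolyTime {X} {list A} as → PolyTime {X ⊗ (B ⊗ A)} {B} f → (q : Poly) →
         (∀ x as → size B (foldr (λ a b → f (x , b , a)) (i x) as) ≤ eval q (size X x + size (list A) as)) →
         PolyTime {X} {B} (λ x → foldr (λ a b → f (x , b , a)) (i x) (as x))
foldrᵖ {X} {B} {A} {i} {as} {f} p l r q bounded =
  PolyTime-≗ (λ x → reverse-foldl (λ b a → f (x , b , a)) (i x) (as x))
    (foldlᵖ p r q (λ x as → subst₂ _≤_
      (cong (size B) (reverse-foldr (λ a b → f (x , b , a)) (i x) as))
      (cong (λ m → eval q (size X x + m)) (size-reverse as))
      (bounded x (reverse as)))
    ∘ᵖ ⟨ idᵖ , reverseᵖ ∘ᵖ l ⟩)

size-foldr : ∀ {g : ⟦ A ⟧ → ⟦ B ⟧ → ⟦ B ⟧} {M G} (b : ⟦ B ⟧) →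
             (∀ a b → size A a ≤ M → size B (g a b) ≤ size B b + G) →
             ∀ as → size (list A) as ≤ M → size B (foldr g b as) ≤ size B b + length as * G
size-foldr b growth [] as≤ = m≤m+n _ 0
size-foldr {A} {B} {g} {M} {G} b growth (a ∷ as) as≤ = begin
  size B (g a (foldr g b as))         ≤⟨ growth a _ (≤-trans (m≤n⇒m≤1+n (m≤m+n _ _)) as≤) ⟩
  size B (foldr g b as) + G
      ≤⟨ +-monoˡ-≤ G (size-foldr b growth as (≤-trans (m≤n⇒m≤1+n (m≤n+m _ (size A a))) as≤)) ⟩
  size B b + length as * G + G        ≡⟨ +-assoc (size B b) _ G ⟩
  size B b + (length as * G + G)      ≡⟨ cong (size B b +_) (+-comm (length as * G) G) ⟩
  size B b + (G + length as * G)      ∎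
  where open ≤-Reasoning

-- If the growth in one step depends on the parameter and the current element but not on the
-- accumulator, the total growth is at most the length times one such amount. This discharges the
-- size hypothesis of most folds below.
additiveᵖ : {i : ⟦ X ⟧ → ⟦ B ⟧} {as : ⟦ X ⟧ → ⟦ list A ⟧} {f : ⟦ X ⊗ (B ⊗ A) ⟧ → ⟦ B ⟧} →
            PolyTime {X} {B} i → PolyTime {X} {list A} as → PolyTime {X ⊗ (B ⊗ A)} {B} f → (r : Poly) →
            (∀ x b a → size B (f (x , b , a)) ≤ size B b + eval r (size X x + size A a)) →
            PolyTime {X} {B} (λ x → foldr (λ a b → f (x , b , a)) (i x) (as x))
additiveᵖ {X} {B} {A} {i} {as} {f} p l s r growth = foldrᵖ p l s (space p ⊞ var ⊠ r) λ x as →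
  ≤-trans
    (size-foldr (i x) (λ a b a≤ → ≤-trans (growth x b a) (+-monoʳ-≤ (size B b)
        (eval-mono r (+-monoʳ-≤ (size X x) a≤)))) as ≤-refl)
    (+-mono-≤ (≤-trans (small p x) (eval-mono (space p) (m≤m+n _ _)))
      (*-monoˡ-≤ (eval r (size X x + size (list A) as)) (≤-trans (size≥length as) (m≤n+m _ (size X x)))))

mapᵖ : {as : ⟦ X ⟧ → ⟦ list A ⟧} {f : ⟦ X ⊗ A ⟧ → ⟦ B ⟧} →
       PolyTime {X} {list A} as → PolyTime {X ⊗ A} {B} f →
       PolyTime {X} {list B} (λ x → map (λ a → f (x , a)) (as x))
mapᵖ {X} {A} {B} {as} {f} l p = PolyTime-≗ (λ x → sym (map-is-foldr (as x)))
  (additiveᵖ nilᵖ l (consᵖ ∘ᵖ ⟨ p ∘ᵖ ⟨ fstᵖ , sndᵖ ∘ᵖ sndᵖ ⟩ , fstᵖ ∘ᵖ sndᵖ ⟩) (con 1 ⊞ space p)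
    λ x b a → ≤-trans (s≤s (+-monoˡ-≤ (size (list B) b) (small p (x , a))))
        (≤-reflexive (+-comm (suc (eval (space p) _)) (size (list B) b))))

size-++ : ∀ (as bs : ⟦ list A ⟧) → size (list A) (as ++ bs) ≡ size (list A) as + size (list A) bs
size-++     []       bs = refl
size-++ {A} (a ∷ as) bs = cong suc (trans (cong (size A a +_) (size-++ as bs)) (sym (+-assoc (size A a) _ _)))

++ᵖ : {as bs : ⟦ X ⟧ → ⟦ list A ⟧} → PolyTime {X} {list A} as → PolyTime {X} {list A} bs →
      PolyTime {X} {list A} (λ x → as x ++ bs x)
++ᵖ {X} {A} {as} {bs} l m = PolyTime-≗ (λ x → sym (++-is-foldr (as x) (bs x)))
  (additiveᵖ m l (consᵖ ∘ᵖ ⟨ sndᵖ ∘ᵖ sndᵖ , fstᵖ ∘ᵖ sndᵖ ⟩) (con 1 ⊞ var)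
    λ x b a → ≤-trans (s≤s (+-monoˡ-≤ (size (list A) b) (m≤n+m (size A a) (size X x))))
        (≤-reflexive (+-comm (suc _) (size (list A) b))))

concatᵖ : {ass : ⟦ X ⟧ → ⟦ list (list A) ⟧} → PolyTime {X} {list (list A)} ass →
          PolyTime {X} {list A} (λ x → concat (ass x))
concatᵖ {X} {A} l = additiveᵖ nilᵖ l (++ᵖ (sndᵖ ∘ᵖ sndᵖ) (fstᵖ ∘ᵖ sndᵖ)) var λ x b as →
  ≤-trans (≤-reflexive (trans (size-++ as b) (+-comm (size (list A) as) _)))
          (+-monoʳ-≤ (size (list A) b) (m≤n+m _ (size X x)))

lengthᵖ : {as : ⟦ X ⟧ → ⟦ list A ⟧} → PolyTime {X} {list A} as → PolyTime {X} {nat} (λ x → length (as x))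
lengthᵖ l = additiveᵖ zeroᵖ l (sucᵖ ∘ᵖ fstᵖ ∘ᵖ sndᵖ) (con 1) (λ x b a → ≤-reflexive (+-comm 1 b))

-- Booleans, decidable equality and filtering

bool : Ty
bool = unit ⊕ unit

⌞_⌟ : Bool → ⟦ bool ⟧
⌞ true  ⌟ = inj₁ tt
⌞ false ⌟ = inj₂ tt

PolyBool : (⟦ X ⟧ → Bool) → Set
PolyBool {X} c = PolyTime {X} {bool} (λ x → ⌞ c x ⌟)

PolyBool-≗ : {c d : ⟦ X ⟧ → Bool} → (∀ x → c x ≡ d x) → PolyBool {X} c → PolyBool {X} d
PolyBool-≗ c≗d = PolyTime-≗ (λ x → cong ⌞_⌟ (c≗d x))

trueᵖ : PolyBool {X} (λ _ → true)
trueᵖ = inlᵖ ∘ᵖ ttᵖ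

falseᵖ : PolyBool {X} (λ _ → false)
falseᵖ = inrᵖ ∘ᵖ ttᵖ

ifᵖ : {c : ⟦ X ⟧ → Bool} {f g : ⟦ X ⟧ → ⟦ A ⟧} →
      PolyBool {X} c → PolyTime {X} {A} f → PolyTime {X} {A} g →
      PolyTime {X} {A} (λ x → if c x then f x else g x)
ifᵖ {X} {A} {c} {f} {g} p q r = PolyTime-≗ branches (caseᵖ p (q ∘ᵖ fstᵖ) (r ∘ᵖ fstᵖ))
  where
  branches : ∀ x → [ (λ _ → f x) , (λ _ → g x) ]′ ⌞ c x ⌟ ≡ (if c x then f x else g x)
  branches x with c x
  ... | true  = refl
  ... | false = refl

∧ᵖ : {c d : ⟦ X ⟧ → Bool} → PolyBool {X} c → PolyBool {X} d → PolyBool {X} (λ x → c x ∧ d x)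
∧ᵖ {c = c} {d} p q = PolyTime-≗ eq (ifᵖ p q falseᵖ)
  where
  eq : ∀ x → (if c x then ⌞ d x ⌟ else ⌞ false ⌟) ≡ ⌞ c x ∧ d x ⌟
  eq x with c x
  ... | true  = refl
  ... | false = refl

∨ᵖ : {c d : ⟦ X ⟧ → Bool} → PolyBool {X} c → PolyBool {X} d → PolyBool {X} (λ x → c x ∨ d x)
∨ᵖ {c = c} {d} p q = PolyTime-≗ eq (ifᵖ p trueᵖ q)
  where
  eq : ∀ x → (if c x then ⌞ true ⌟ else ⌞ d x ⌟) ≡ ⌞ c x ∨ d x ⌟
  eq x with c x
  ... | true  = refl
  ... | false = refl

notᵖ : {c : ⟦ X ⟧ → Bool} → PolyBool {X} c → PolyBool {X} (λ x → not (c x))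
notᵖ {c = c} p = PolyTime-≗ eq (ifᵖ p falseᵖ trueᵖ)
  where
  eq : ∀ x → (if c x then ⌞ false ⌟ else ⌞ true ⌟) ≡ ⌞ not (c x) ⌟
  eq x with c x
  ... | true  = refl
  ... | false = refl

PolyEq : ∀ A → DecidableEquality ⟦ A ⟧ → Set
PolyEq A _≟_ = PolyBool {A ⊗ A} (λ (x , y) → does (x ≟ y))

unit-eqᵖ : PolyEq unit Unit._≟_
unit-eqᵖ = trueᵖ

pair-eqᵖ : {_≟₁_ : DecidableEquality ⟦ A ⟧} {_≟₂_ : DecidableEquality ⟦ B ⟧} →
           PolyEq A _≟₁_ → PolyEq B _≟₂_ → PolyEq (A ⊗ B) (Product.≡-dec _≟₁_ _≟₂_)
pair-eqᵖ {_≟₁_ = _≟₁_} {_≟₂_} p q = PolyBool-≗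
  (λ ((a , x) , (b , y)) → does-⇔ (mk⇔ (uncurry (cong₂ _,_)) Product.,-injective)
      (a ≟₁ b ×-dec x ≟₂ y) (Product.≡-dec _≟₁_ _≟₂_ (a , x) (b , y)))
  (∧ᵖ (p ∘ᵖ ⟨ fstᵖ ∘ᵖ fstᵖ , fstᵖ ∘ᵖ sndᵖ ⟩) (q ∘ᵖ ⟨ sndᵖ ∘ᵖ fstᵖ , sndᵖ ∘ᵖ sndᵖ ⟩))

module _ {A : Ty} {_≟_ : DecidableEquality ⟦ A ⟧} where

  private
    -- Two lists are compared by one fold over the first, which strips matching heads off the
    -- second. `inj₁` records a mismatch for good; the lists are equal exactly when `inj₂ []`
    -- remains.
    strip : ⟦ unit ⊕ list A ⟧ → ⟦ A ⟧ → ⟦ unit ⊕ list A ⟧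
    strip s x = [ (λ _ → inj₁ tt)
                , (λ ys → [ (λ _ → inj₁ tt)
                          , (λ (y , ys′) → if does (x ≟ y) then inj₂ ys′ else inj₁ tt) ]′ (uncons′ ys)) ]′ s

    finish : ⟦ unit ⊕ list A ⟧ → ⟦ bool ⟧
    finish s = [ (λ _ → ⌞ false ⌟) , (λ ys → [ (λ _ → ⌞ true ⌟) , (λ _ → ⌞ false ⌟) ]′ (uncons′ ys)) ]′ s

    strip-failed : ∀ xs → foldl strip (inj₁ tt) xs ≡ inj₁ tt
    strip-failed []       = refl
    strip-failed (x ∷ xs) = strip-failed xs

    size-strip : ∀ s x → size (unit ⊕ list A) (strip s x) ≤ size (unit ⊕ list A) s
    size-strip (inj₁ _)        x = z≤n
    size-strip (inj₂ [])       x = z≤n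
    size-strip (inj₂ (y ∷ ys)) x with does (x ≟ y)
    ... | true  = m≤n⇒m≤1+n (m≤n+m _ (size A y))
    ... | false = z≤n

    size-strips : ∀ s xs → size (unit ⊕ list A) (foldl strip s xs) ≤ size (unit ⊕ list A) s
    size-strips s []       = ≤-refl
    size-strips s (x ∷ xs) = ≤-trans (size-strips (strip s x) xs) (size-strip s x)

    strip-correct : ∀ xs ys → finish (foldl strip (inj₂ ys) xs) ≡ ⌞ does (≡-dec _≟_ xs ys) ⌟
    strip-correct []       []       = refl
    strip-correct []       (y ∷ ys) = refl
    strip-correct (x ∷ xs) []       = cong finish (strip-failed xs)
    strip-correct (x ∷ xs) (y ∷ ys) with does (x ≟ y)
    ... | true  = strip-correct xs ys
    ... | false = cong finish (strip-failed xs)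

  list-eqᵖ : PolyEq A _≟_ → PolyEq (list A) (≡-dec _≟_)
  list-eqᵖ p = PolyTime-≗ (λ (xs , ys) → strip-correct xs ys)
    (caseᵖ (foldlᵖ {X = list A} inrᵖ stripᵖ var
             (λ ys xs → ≤-trans (size-strips (inj₂ ys) xs) (m≤m+n _ _)) ∘ᵖ ⟨ sndᵖ , fstᵖ ⟩)
      falseᵖ
      (caseᵖ (unconsᵖ ∘ᵖ sndᵖ) trueᵖ falseᵖ))
    where
    stripᵖ : PolyTime {list A ⊗ ((unit ⊕ list A) ⊗ A)} {unit ⊕ list A} (λ (_ , s , x) → strip s x)
    stripᵖ = caseᵖ (fstᵖ ∘ᵖ sndᵖ) falsy (caseᵖ (unconsᵖ ∘ᵖ sndᵖ) falsy
               (ifᵖ (p ∘ᵖ ⟨ sndᵖ ∘ᵖ sndᵖ ∘ᵖ fstᵖ ∘ᵖ fstᵖ , fstᵖ ∘ᵖ sndᵖ ⟩) (inrᵖ ∘ᵖ sndᵖ ∘ᵖ sndᵖ) falsy))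
      where
      falsy : ∀ {Y} → PolyTime {Y} {unit ⊕ list A} (λ _ → inj₁ tt)
      falsy = inlᵖ ∘ᵖ ttᵖ

-- Numbers are compared as lists of units, which reuses the comparison of lists.
nat-eqᵖ : PolyEq nat _≟_
nat-eqᵖ = PolyBool-≗
  (λ (m , n) → does-⇔ (mk⇔ replicate-injective (cong (λ k → replicate k tt)))
      (≡-dec Unit._≟_ (replicate m tt) (replicate n tt)) (m ≟ n))
  (list-eqᵖ unit-eqᵖ ∘ᵖ ⟨ unitsᵖ ∘ᵖ fstᵖ , unitsᵖ ∘ᵖ sndᵖ ⟩)
  where
  replicate-injective : ∀ {m n} → replicate m tt ≡ replicate n tt → m ≡ n
  replicate-injective {m} {n} eq =
    trans (sym (length-replicate m)) (trans (cong length eq) (length-replicate n))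

filterᵖ : {as : ⟦ X ⟧ → ⟦ list A ⟧} {P : ⟦ X ⊗ A ⟧ → Set} {P? : Decidable P} →
          PolyTime {X} {list A} as → PolyBool {X ⊗ A} (λ xa → does (P? xa)) →
          PolyTime {X} {list A} (λ x → filter (λ a → P? (x , a)) (as x))
filterᵖ {X} {A} {as} {P} {P?} l p = PolyTime-≗ (λ x → filter-is-foldr x (as x))
  (additiveᵖ nilᵖ l (ifᵖ (p ∘ᵖ ⟨ fstᵖ , sndᵖ ∘ᵖ sndᵖ ⟩)
      (consᵖ ∘ᵖ ⟨ sndᵖ ∘ᵖ sndᵖ , fstᵖ ∘ᵖ sndᵖ ⟩) (fstᵖ ∘ᵖ sndᵖ)) (con 1 ⊞ var) growth)
  where
  step : ⟦ X ⟧ → ⟦ A ⟧ → ⟦ list A ⟧ → ⟦ list A ⟧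
  step x a b = if does (P? (x , a)) then a ∷ b else b

  filter-is-foldr : ∀ x as → foldr (step x) [] as ≡ filter (λ a → P? (x , a)) as
  filter-is-foldr x []       = refl
  filter-is-foldr x (a ∷ as) with does (P? (x , a))
  ... | true  = cong (a ∷_) (filter-is-foldr x as)
  ... | false = filter-is-foldr x as

  growth : ∀ x b a → size (list A) (step x a b) ≤ size (list A) b + suc (size X x + size A a)
  growth x b a with does (P? (x , a))
  ... | true  = ≤-trans (s≤s (+-monoˡ-≤ (size (list A) b) (m≤n+m _ (size X x))))
      (≤-reflexive (+-comm _ (size (list A) b)))
  ... | false = m≤m+n _ _

size-filter : {P : ⟦ A ⟧ → Set} (P? : Decidable P) → ∀ as → size (list A) (filter P? as) ≤ size (list A) as
size-filter     P? []       = z≤n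
size-filter {A} P? (a ∷ as) with does (P? a)
... | true  = s≤s (+-monoʳ-≤ (size A a) (size-filter P? as))
... | false = ≤-trans (size-filter P? as) (m≤n⇒m≤1+n (m≤n+m _ (size A a)))

deduplicateᵖ : {_≟_ : DecidableEquality ⟦ A ⟧} → PolyEq A _≟_ → PolyTime {list A} {list A} (deduplicate _≟_)
deduplicateᵖ {A} {_≟_} p = PolyTime-≗ deduplicate-is-foldr
  (additiveᵖ nilᵖ idᵖ
    (consᵖ ∘ᵖ ⟨ sndᵖ ∘ᵖ sndᵖ , filterᵖ {P? = λ ((_ , _ , x) , a) → ¬? (x ≟ a)} (fstᵖ ∘ᵖ sndᵖ)
        (notᵖ (p ∘ᵖ ⟨ sndᵖ ∘ᵖ sndᵖ ∘ᵖ fstᵖ , sndᵖ ⟩)) ⟩)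
    (con 1 ⊞ var) growth)
  where
  step : ⟦ A ⟧ → ⟦ list A ⟧ → ⟦ list A ⟧
  step a b = a ∷ filter (λ a′ → ¬? (a ≟ a′)) b

  deduplicate-is-foldr : ∀ as → foldr step [] as ≡ deduplicate _≟_ as
  deduplicate-is-foldr []       = refl
  deduplicate-is-foldr (a ∷ as) = cong (step a) (deduplicate-is-foldr as)

  growth : ∀ (x b : ⟦ list A ⟧) a → size (list A) (step a b) ≤ size (list A) b + suc (size (list A) x + size A a)
  growth x b a = ≤-trans (s≤s (+-mono-≤ (m≤n+m (size A a) (size (list A) x)) (size-filter _ b)))
      (≤-reflexive (+-comm _ (size (list A) b)))

size-bool : ∀ b → size bool ⌞ b ⌟ ≡ 0
size-bool true  = refl
size-bool false = refl

truth : ⟦ bool ⟧ → Bool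
truth (inj₁ _) = true
truth (inj₂ _) = false

truthᵖ : {b : ⟦ X ⟧ → ⟦ bool ⟧} → PolyTime {X} {bool} b → PolyBool {X} (λ x → truth (b x))
truthᵖ {b = b} = PolyTime-≗ (λ x → ⌞truth⌟ (b x))
  where
  ⌞truth⌟ : ∀ b → b ≡ ⌞ truth b ⌟
  ⌞truth⌟ (inj₁ _) = refl
  ⌞truth⌟ (inj₂ _) = refl

truth-⌞⌟ : ∀ b → truth ⌞ b ⌟ ≡ b
truth-⌞⌟ true  = refl
truth-⌞⌟ false = refl

all?ᵖ : {as : ⟦ X ⟧ → ⟦ list A ⟧} {P : ⟦ X ⊗ A ⟧ → Set} {P? : Decidable P} →
        PolyTime {X} {list A} as → PolyBool {X ⊗ A} (λ xa → does (P? xa)) →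
        PolyBool {X} (λ x → does (All.all? (λ a → P? (x , a)) (as x)))
all?ᵖ {X} {A} {as} {P} {P?} l p = PolyTime-≗ (λ x → all?-is-foldr x (as x))
  (additiveᵖ trueᵖ l (∧ᵖ (p ∘ᵖ ⟨ fstᵖ , sndᵖ ∘ᵖ sndᵖ ⟩) (truthᵖ (fstᵖ ∘ᵖ sndᵖ))) (con 0)
    λ x b a → ≤-trans (≤-reflexive (size-bool (does (P? (x , a)) ∧ truth b))) z≤n)
  where
  all?-is-foldr : ∀ x as → foldr (λ a b → ⌞ does (P? (x , a)) ∧ truth b ⌟) ⌞ true ⌟ as
      ≡ ⌞ does (All.all? (λ a → P? (x , a)) as) ⌟
  all?-is-foldr x []       = refl
  all?-is-foldr x (a ∷ as) = cong (λ b → ⌞ does (P? (x , a)) ∧ b ⌟)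
    (trans (cong truth (all?-is-foldr x as)) (truth-⌞⌟ _))

any?ᵖ : {as : ⟦ X ⟧ → ⟦ list A ⟧} {P : ⟦ X ⊗ A ⟧ → Set} {P? : Decidable P} →
        PolyTime {X} {list A} as → PolyBool {X ⊗ A} (λ xa → does (P? xa)) →
        PolyBool {X} (λ x → does (Any.any? (λ a → P? (x , a)) (as x)))
any?ᵖ {X} {A} {as} {P} {P?} l p = PolyTime-≗ (λ x → any?-is-foldr x (as x))
  (additiveᵖ falseᵖ l (∨ᵖ (p ∘ᵖ ⟨ fstᵖ , sndᵖ ∘ᵖ sndᵖ ⟩) (truthᵖ (fstᵖ ∘ᵖ sndᵖ))) (con 0)
    λ x b a → ≤-trans (≤-reflexive (size-bool (does (P? (x , a)) ∨ truth b))) z≤n)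
  where
  any?-is-foldr : ∀ x as → foldr (λ a b → ⌞ does (P? (x , a)) ∨ truth b ⌟) ⌞ false ⌟ as
      ≡ ⌞ does (Any.any? (λ a → P? (x , a)) as) ⌟
  any?-is-foldr x []       = refl
  any?-is-foldr x (a ∷ as) = cong (λ b → ⌞ does (P? (x , a)) ∨ b ⌟)
    (trans (cong truth (any?-is-foldr x as)) (truth-⌞⌟ _))

-- Indices, lookup and iteration

size-list : ∀ {M} (as : ⟦ list A ⟧) → All (λ a → size A a ≤ M) as → size (list A) as ≤ length as * suc M
size-list []       []           = z≤n
size-list (a ∷ as) (a≤ ∷ as≤) = s≤s (+-mono-≤ a≤ (size-list as as≤))

-- Each step increments all numbers collected so far, so the growth depends on the accumulator and
-- `additiveᵖ` does not apply. The accumulators are initial segments of the naturals, whose size is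
-- quadratic in their length.
upToᵖ : {as : ⟦ X ⟧ → ⟦ list A ⟧} → PolyTime {X} {list A} as → PolyTime {X} {list nat} (λ x → upTo (length (as x)))
upToᵖ {X} {A} {as} l = PolyTime-≗ (λ x → upTo-is-foldr (as x))
  (foldrᵖ nilᵖ l (consᵖ ∘ᵖ ⟨ zeroᵖ , mapᵖ (fstᵖ ∘ᵖ sndᵖ) (sucᵖ ∘ᵖ sndᵖ) ⟩) (var ⊠ (con 1 ⊞ var)) bounded)
  where
  upTo-is-foldr : ∀ {A : Set} (as : List A) → foldr (λ _ is → 0 ∷ map suc is) [] as ≡ upTo (length as)
  upTo-is-foldr []       = refl
  upTo-is-foldr (a ∷ as) = cong (0 ∷_) (trans (cong (map suc) (upTo-is-foldr as)) (map-upTo suc (length as)))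

  bounded : ∀ x as → size (list nat) (foldr (λ _ is → 0 ∷ map suc is) [] as)
      ≤ (size X x + size (list A) as) * suc (size X x + size (list A) as)
  bounded x as = begin
    size (list nat) (foldr (λ _ is → 0 ∷ map suc is) [] as) ≡⟨ cong (size (list nat)) (upTo-is-foldr as) ⟩
    size (list nat) (upTo (length as))
        ≤⟨ size-list (upTo (length as)) (All.applyUpTo⁺₁ id (length as) <⇒≤) ⟩
    length (upTo (length as)) * suc (length as)
        ≡⟨ cong (_* suc (length as)) (length-upTo (length as)) ⟩
    length as * suc (length as)                              ≤⟨ *-mono-≤ len≤ (s≤s len≤) ⟩
    (size X x + size (list A) as) * suc (size X x + size (list A) as) ∎
    where
    open ≤-Reasoning
    len≤ = ≤-trans (size≥length as) (m≤n+m _ (size X x))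

cartesianProductWithᵖ : {as : ⟦ X ⟧ → ⟦ list A ⟧} {bs : ⟦ X ⟧ → ⟦ list B ⟧} {f : ⟦ A ⊗ B ⟧ → ⟦ C ⟧} →
  PolyTime {X} {list A} as → PolyTime {X} {list B} bs → PolyTime {A ⊗ B} {C} f →
  PolyTime {X} {list C} (λ x → cartesianProductWith (λ a b → f (a , b)) (as x) (bs x))
cartesianProductWithᵖ {as = as} {bs} {f} l m p = PolyTime-≗ (λ x → product-is-concat (as x) (bs x))
  (concatᵖ (mapᵖ l (mapᵖ (m ∘ᵖ fstᵖ) (p ∘ᵖ ⟨ sndᵖ ∘ᵖ fstᵖ , sndᵖ ⟩))))
  where
  product-is-concat : ∀ as bs → concat (map (λ a → map (λ b → f (a , b)) bs) as)
      ≡ cartesianProductWith (λ a b → f (a , b)) as bs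
  product-is-concat []       bs = refl
  product-is-concat (a ∷ as) bs = cong (map (λ b → f (a , b)) bs ++_) (product-is-concat as bs)

at : {A : Set} → A → List A → ℕ → A
at d []       i       = d
at d (x ∷ xs) zero    = x
at d (x ∷ xs) (suc i) = at d xs i

size-at : ∀ xs i → at 0 xs i ≤ size (list nat) xs
size-at []       i       = z≤n
size-at (x ∷ xs) zero    = m≤n⇒m≤1+n (m≤m+n _ _)
size-at (x ∷ xs) (suc i) = ≤-trans (size-at xs i) (m≤n⇒m≤1+n (m≤n+m _ x))

-- A fold over as many units as the index says drops one element per unit. Dropping from `[]` gives
-- `[]`, so an index out of range leads to the default.
atᵖ : {d : ⟦ A ⟧} {xs : ⟦ X ⟧ → ⟦ list A ⟧} {i : ⟦ X ⟧ → ℕ} → (∀ {X} → PolyTime {X} {A} (λ _ → d)) →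
      PolyTime {X} {list A} xs → PolyTime {X} {nat} i → PolyTime {X} {A} (λ x → at d (xs x) (i x))
atᵖ {A} {X} {d} {xs} {i} dᵖ l p = PolyTime-≗ (λ x → at-drops (xs x) (i x))
  (caseᵖ (unconsᵖ ∘ᵖ foldlᵖ {X = list A} {A = unit} idᵖ tailᵖ var
      (λ xs us → ≤-trans (size-drops xs us) (m≤m+n _ _)) ∘ᵖ ⟨ l , unitsᵖ ∘ᵖ p ⟩)
    dᵖ (fstᵖ ∘ᵖ sndᵖ))
  where
  tail′ : ⟦ list A ⟧ → ⟦ list A ⟧
  tail′ xs = [ (λ _ → []) , proj₂ ]′ (uncons′ xs)

  head′ : ⟦ list A ⟧ → ⟦ A ⟧
  head′ xs = [ (λ _ → d) , proj₁ ]′ (uncons′ xs)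

  drops : ⟦ list A ⟧ → List ⊤ → ⟦ list A ⟧
  drops = foldl (λ xs _ → tail′ xs)

  tailᵖ : PolyTime {list A ⊗ (list A ⊗ unit)} {list A} (λ (_ , xs , _) → tail′ xs)
  tailᵖ = caseᵖ (unconsᵖ ∘ᵖ fstᵖ ∘ᵖ sndᵖ) nilᵖ (sndᵖ ∘ᵖ sndᵖ)

  size-drops : ∀ xs us → size (list A) (drops xs us) ≤ size (list A) xs
  size-drops xs       []       = ≤-refl
  size-drops []       (u ∷ us) = size-drops [] us
  size-drops (x ∷ xs) (u ∷ us) = ≤-trans (size-drops xs us) (m≤n⇒m≤1+n (m≤n+m _ (size A x)))

  at-drops : ∀ xs i → head′ (drops xs (replicate i tt)) ≡ at d xs i
  at-drops []       zero    = refl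
  at-drops []       (suc i) = at-drops [] i
  at-drops (x ∷ xs) zero    = refl
  at-drops (x ∷ xs) (suc i) = at-drops xs i

-- The index is the length of the list if the element does not occur.
indexOf : {A : Set} → DecidableEquality A → A → List A → ℕ
indexOf _≟_ x = foldr (λ y i → if does (x ≟ y) then 0 else suc i) 0

indexOfᵖ : (_≟_ : DecidableEquality ⟦ A ⟧) {a : ⟦ X ⟧ → ⟦ A ⟧} {as : ⟦ X ⟧ → ⟦ list A ⟧} →
           PolyEq A _≟_ → PolyTime {X} {A} a → PolyTime {X} {list A} as →
           PolyTime {X} {nat} (λ x → indexOf _≟_ (a x) (as x))
indexOfᵖ _≟_ {a} {as} e p l = additiveᵖ zeroᵖ l
  (ifᵖ (e ∘ᵖ ⟨ p ∘ᵖ fstᵖ , sndᵖ ∘ᵖ sndᵖ ⟩) zeroᵖ (sucᵖ ∘ᵖ fstᵖ ∘ᵖ sndᵖ)) (con 1) growth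
  where
  growth : ∀ x i y → (if does (a x ≟ y) then 0 else suc i) ≤ i + 1
  growth x i y with does (a x ≟ y)
  ... | true  = z≤n
  ... | false = ≤-reflexive (+-comm 1 i)

assoc : ℕ → List (ℕ × ℕ) → ℕ
assoc x = foldr (λ (y , z) w → if does (x ≟ y) then z else w) 0

assocᵖ : {a : ⟦ X ⟧ → ℕ} {ps : ⟦ X ⟧ → List (ℕ × ℕ)} →
         PolyTime {X} {nat} a → PolyTime {X} {list (nat ⊗ nat)} ps →
         PolyTime {X} {nat} (λ x → assoc (a x) (ps x))
assocᵖ {X} {a} p l = additiveᵖ zeroᵖ l
  (ifᵖ (nat-eqᵖ ∘ᵖ ⟨ p ∘ᵖ fstᵖ , fstᵖ ∘ᵖ sndᵖ ∘ᵖ sndᵖ ⟩) (sndᵖ ∘ᵖ sndᵖ ∘ᵖ sndᵖ) (fstᵖ ∘ᵖ sndᵖ)) var growth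
  where
  growth : ∀ x w ((y , z) : ℕ × ℕ) → (if does (a x ≟ y) then z else w) ≤ w + (size X x + (y + z))
  growth x w (y , z) with does (a x ≟ y)
  ... | true  = ≤-trans (m≤n+m z y) (≤-trans (m≤n+m _ (size X x)) (m≤n+m _ w))
  ... | false = m≤m+n _ _

-- The bound on values of f must not depend on the iterated argument: otherwise polynomial growth at
-- each of many steps could compound to exponential size.
iterateᵖ : {f : ⟦ X ⊗ A ⟧ → ⟦ A ⟧} {a : ⟦ X ⟧ → ⟦ A ⟧} {us : ⟦ X ⟧ → ⟦ list B ⟧} →
           PolyTime {X ⊗ A} {A} f → PolyTime {X} {A} a → PolyTime {X} {list B} us →
           (r : Poly) → (∀ x a → size A (f (x , a)) ≤ eval r (size X x)) →
           PolyTime {X} {list A} (λ x → iterate (λ a → f (x , a)) (a x) (length (us x)))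
iterateᵖ {X} {A} {B} {f} {a} {us} p q l r bounded = PolyTime-≗
  (λ x → trans (cong reverse (trajectory x (a x) [] (us x)))
      (reverse-involutive (iterate (λ a → f (x , a)) (a x) (length (us x)))))
  (reverseᵖ ∘ᵖ sndᵖ ∘ᵖ foldlᵖ {A = B} ⟨ q , nilᵖ ⟩ stepᵖ ((r ⊞ space q) ⊞ var ⊠ (con 1 ⊞ (r ⊞ space q)))
    (λ x us → ≤-trans
      (small-trajectory x (eval r (size X x) + eval (space q) (size X x)) (m≤m+n _ _) (a x) [] (≤-trans (small q x) (m≤n+m _ _)) us)
      (+-mono-≤ (R≤ x us) (*-mono-≤ (≤-trans (size≥length us) (m≤n+m _ (size X x))) (s≤s (R≤ x us)))))
    ∘ᵖ ⟨ idᵖ , l ⟩)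
  where
  step : ⟦ X ⟧ → ⟦ A ⊗ list A ⟧ → ⟦ A ⊗ list A ⟧
  step x (a , as) = f (x , a) , a ∷ as

  stepᵖ : PolyTime {X ⊗ ((A ⊗ list A) ⊗ B)} {A ⊗ list A} (λ (x , s , _) → step x s)
  stepᵖ = ⟨ p ∘ᵖ ⟨ fstᵖ , fstᵖ ∘ᵖ fstᵖ ∘ᵖ sndᵖ ⟩ , consᵖ ∘ᵖ fstᵖ ∘ᵖ sndᵖ ⟩

  R≤ : ∀ x us → eval r (size X x) + eval (space q) (size X x)
              ≤ eval r (size X x + size (list B) us) + eval (space q) (size X x + size (list B) us)
  R≤ x us = +-mono-≤ (eval-mono r (m≤m+n _ _)) (eval-mono (space q) (m≤m+n _ _))

  trajectory : ∀ x a as (us : ⟦ list B ⟧) → proj₂ (foldl (λ s _ → step x s) (a , as) us)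
                           ≡ reverseAcc as (iterate (λ a → f (x , a)) a (length us))
  trajectory x a as []       = refl
  trajectory x a as (u ∷ us) = trajectory x (f (x , a)) (a ∷ as) us

  small-trajectory : ∀ x R → eval r (size X x) ≤ R → ∀ a as → size A a ≤ R → ∀ (us : ⟦ list B ⟧) →
    size (A ⊗ list A) (foldl (λ s _ → step x s) (a , as) us) ≤ R + (size (list A) as + length us * suc R)
  small-trajectory x R r≤ a as a≤ []       = +-mono-≤ a≤ (m≤m+n _ _)
  small-trajectory x R r≤ a as a≤ (u ∷ us) = ≤-trans
    (small-trajectory x R r≤ (f (x , a)) (a ∷ as) (≤-trans (bounded x a) r≤) us)
    (+-monoʳ-≤ R (≤-trans (+-monoˡ-≤ (length us * suc R) (s≤s (+-monoˡ-≤ (size (list A) as) a≤)))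
      (≤-reflexive (trans (cong (_+ length us * suc R) (+-comm (suc R) (size (list A) as)))
          (+-assoc (size (list A) as) _ _)))))

-- Degrees and the final form of the bound

-- The base 2 + n ≥ 2 lets constant factors and nested polynomials be absorbed
-- into the exponent.
degree : Poly → ℕ
degree (con c) = c
degree var     = 1
degree (p ⊞ q) = suc (degree p + degree q)
degree (p ⊠ q) = degree p + degree q
degree (p ⊡ q) = (2 + degree q) * degree p

eval≤^degree : ∀ p n → eval p n ≤ (2 + n) ^ degree p
eval≤^degree p n = bound p
  where
  m = 2 + n

  1≤^ : ∀ a → 1 ≤ m ^ a
  1≤^ = m^n>0 m

  sum≤^ : ∀ {x y} a → x ≤ m ^ a → y ≤ m ^ a → x + y ≤ m ^ suc a
  sum≤^ a x≤ y≤ = +-mono-≤ x≤ (≤-trans y≤ (m≤m+n _ (n * m ^ a)))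

  constant≤^ : ∀ c → c ≤ m ^ c
  constant≤^ zero    = z≤n
  constant≤^ (suc c) = sum≤^ c (1≤^ c) (constant≤^ c)

  bound : ∀ p → eval p n ≤ m ^ degree p
  bound (con c) = constant≤^ c
  bound var     = ≤-trans (m≤n+m n 2) (≤-reflexive (sym (*-identityʳ m)))
  bound (p ⊞ q) = sum≤^ (degree p + degree q)
    (≤-trans (bound p) (^-monoʳ-≤ m (m≤m+n (degree p) (degree q))))
    (≤-trans (bound q) (^-monoʳ-≤ m (m≤n+m (degree q) (degree p))))
  bound (p ⊠ q) = ≤-trans (*-mono-≤ (bound p) (bound q))
    (≤-reflexive (sym (^-distribˡ-+-* m (degree p) (degree q))))
  -- The induction hypothesis for p is taken at q(n), where the base is 2 + q(n). Absorbing the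
  -- summand 2 costs two extra factors m, whence the 2 in `degree`.
  bound (p ⊡ q) = begin
    eval p (eval q n)                     ≤⟨ eval≤^degree p (eval q n) ⟩
    (2 + eval q n) ^ degree p             ≤⟨ ^-monoˡ-≤ (degree p) (sum≤^ (suc (degree q))
                                              (sum≤^ (degree q) (1≤^ (degree q)) (1≤^ (degree q)))
                                              (≤-trans (bound q) (^-monoʳ-≤ m (n≤1+n (degree q))))) ⟩
    (m ^ (2 + degree q)) ^ degree p       ≡⟨ ^-*-assoc m (2 + degree q) (degree p) ⟩
    m ^ ((2 + degree q) * degree p)       ∎
    where open ≤-Reasoning

-- For n at least 2, 2 + n is at most n²; for n = 0 and n = 1 the base is at most 3 and the constant
-- term pays.
2+n^d≤ : ∀ n d → (2 + n) ^ d ≤ 3 ^ d * n ^ (2 * d) + 3 ^ d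
2+n^d≤ 0 d = ≤-trans (^-monoˡ-≤ d (n≤1+n 2)) (m≤n+m (3 ^ d) _)
2+n^d≤ 1 d = m≤n+m (3 ^ d) _
2+n^d≤ n@(suc (suc m)) d = begin
  (2 + n) ^ d                       ≤⟨ ^-monoˡ-≤ d 2+n≤n² ⟩
  (n ^ 2) ^ d                       ≡⟨ ^-*-assoc n 2 d ⟩
  n ^ (2 * d)                       ≡⟨ *-identityˡ _ ⟨
  1 * n ^ (2 * d)                   ≤⟨ *-monoˡ-≤ (n ^ (2 * d)) (m^n>0 3 d) ⟩
  3 ^ d * n ^ (2 * d)               ≤⟨ m≤m+n _ (3 ^ d) ⟩
  3 ^ d * n ^ (2 * d) + 3 ^ d       ∎
  where
  open ≤-Reasoning
  2+n≤n² : 2 + n ≤ n ^ 2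
  2+n≤n² = begin
    2 + n        ≤⟨ +-monoˡ-≤ n (m≤m+n 2 m) ⟩
    n + n        ≤⟨ m≤m+n (n + n) (m * n) ⟩
    n + n + m * n  ≡⟨ +-assoc n n (m * n) ⟩
    n * n        ≡⟨ cong (n *_) (*-identityʳ n) ⟨
    n ^ 2        ∎

polynomially-bounded : ∀ p → ∃[ c ] ∃[ d ] ∀ n → eval p n ≤ c * n ^ d + c
polynomially-bounded p = 3 ^ degree p , 2 * degree p , λ n → ≤-trans (eval≤^degree p n) (2+n^d≤ n (degree p))

-- The program

-- This is σₛσᵣ⁻¹ on lists: find the column in which row R holds x, and read row S there.
advance : List ℕ × List ℕ → ℕ → ℕ
advance (R , S) x = at 0 S (indexOf _≟_ x R)

-- Since γ conjugates one relative permutation to the other, advancing both coordinates of a pair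
-- (x, γ(x)) stays on the graph of γ. One seed per cycle thus spreads to the whole graph, and n
-- iterates exhaust any cycle.
advance₂ : (List ℕ × List ℕ) × (List ℕ × List ℕ) → ℕ × ℕ → ℕ × ℕ
advance₂ (ρ , ρ′) (x , y) = advance ρ x , advance ρ′ y

orbits : ℕ → (List ℕ × List ℕ) × (List ℕ × List ℕ) → List (ℕ × ℕ) → List (ℕ × ℕ)
orbits n ρs seeds = concat (map (λ c → iterate (advance₂ ρs) c n) seeds)

symbolList : ℕ → List (ℕ × ℕ) → List ℕ
symbolList n table = map (λ x → assoc x table) (upTo n)

columnList : List ℕ → List ℕ → List ℕ → List ℕ
columnList R R′ γ = map (λ x → indexOf _≟_ (at 0 γ x) R′) R

-- From γσᵢ = σ_{α(i)}β: the row γσᵢ is searched among all rows precomposed with β, and its position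
-- is α(i).
rowList : List (List ℕ) → List ℕ → List ℕ → List ℕ
rowList L β γ = map (λ T → indexOf (≡-dec _≟_) (map (at 0 γ) T) (map (λ T′ → map (at 0 T′) β) L)) L

reconstruct : List (List ℕ) → (List ℕ × List ℕ) × (List ℕ × List ℕ) → List (ℕ × ℕ) → ⟦ isotopismTy ⟧
reconstruct L ρs@((R , S) , (R′ , S′)) seeds = rowList L β γ , β , γ
  where
  γ = symbolList (length L) (orbits (length L) ρs seeds)
  β = columnList R R′ γ

-- Each pair is an index with its guessed image, under α for the first two and under γ for the rest.
-- The last clause is never reached by tuples of length 2 + k.
candidate : List (List ℕ) → List (ℕ × ℕ) → ⟦ isotopismTy ⟧
candidate L ((r , r′) ∷ (s , s′) ∷ seeds) =
  reconstruct L ((at [] L r , at [] L s) , (at [] L r′ , at [] L s′)) seeds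
candidate L _ = [] , [] , []

tuples : {A : Set} → ℕ → List A → List (List A)
tuples zero    xs = [] ∷ []
tuples (suc k) xs = cartesianProductWith _∷_ xs (tuples k xs)

candidates : ℕ → List (List ℕ) → List ⟦ isotopismTy ⟧
candidates k L = map (candidate L) (tuples k (cartesianProduct (upTo (length L)) (upTo (length L))))

transpose′ : List (List ℕ) → List (List ℕ)
transpose′ L = map (λ j → map (λ R → at 0 R j) L) (upTo (length L))

swap′ : ⟦ isotopismTy ⟧ → ⟦ isotopismTy ⟧
swap′ (α , β , γ) = β , α , γ

IsPermutation : ℕ → List ℕ → Set
IsPermutation n xs = length xs ≡ n × All (_∈ xs) (upTo n)

isPermutation? : ∀ n → Decidable (IsPermutation n)
isPermutation? n xs = length xs ≟ n ×-dec All.all? (_∈? xs) (upTo n)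

IsAutotopism : List (List ℕ) × ⟦ isotopismTy ⟧ → Set
IsAutotopism (L , α , β , γ) =
    IsPermutation (length L) α × IsPermutation (length L) β × IsPermutation (length L) γ
  × map (map (at 0 γ)) L ≡ map (λ i → map (at 0 (at [] L i)) β) α

isAutotopism? : Decidable IsAutotopism
isAutotopism? (L , α , β , γ) =
        isPermutation? (length L) α ×-dec isPermutation? (length L) β ×-dec isPermutation? (length L) γ
  ×-dec ≡-dec (≡-dec _≟_) (map (map (at 0 γ)) L) (map (λ i → map (at 0 (at [] L i)) β) α)

_≟ᵢ_ : DecidableEquality ⟦ isotopismTy ⟧
_≟ᵢ_ = Product.≡-dec (≡-dec _≟_) (Product.≡-dec (≡-dec _≟_) (≡-dec _≟_))

autotopisms : ℕ → List (List ℕ) → List ⟦ isotopismTy ⟧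
autotopisms k L = deduplicate _≟ᵢ_ (filter (λ Θ → isAutotopism? (L , Θ))
  (candidates k L ++ map swap′ (candidates k (transpose′ L))))

-- Running time of the program

π₁ : {f : ⟦ X ⟧ → ⟦ A ⊗ B ⟧} → PolyTime {X} {A ⊗ B} f → PolyTime {X} {A} (λ x → proj₁ (f x))
π₁ p = fstᵖ ∘ᵖ p

π₂ : {f : ⟦ X ⟧ → ⟦ A ⊗ B ⟧} → PolyTime {X} {A ⊗ B} f → PolyTime {X} {B} (λ x → proj₂ (f x))
π₂ p = sndᵖ ∘ᵖ p

advanceᵖ : {ρ : ⟦ X ⟧ → List ℕ × List ℕ} {x : ⟦ X ⟧ → ℕ} →
        PolyTime {X} {permTy ⊗ permTy} ρ → PolyTime {X} {nat} x →
        PolyTime {X} {nat} (λ z → advance (ρ z) (x z))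
advanceᵖ p q = atᵖ zeroᵖ (π₂ p) (indexOfᵖ _≟_ nat-eqᵖ q (π₁ p))

pairsTy rowsTy : Ty
pairsTy = list (nat ⊗ nat)
rowsTy  = (permTy ⊗ permTy) ⊗ (permTy ⊗ permTy)

orbitsᵖ : PolyTime {squareTy ⊗ rowsTy ⊗ pairsTy} {pairsTy}
            (λ (L , ρs , seeds) → orbits (length L) ρs seeds)
orbitsᵖ = concatᵖ (mapᵖ (π₂ sndᵖ) (iterateᵖ
  ⟨ advanceᵖ (π₁ (π₁ (π₂ (π₁ fstᵖ)))) (π₁ sndᵖ) , advanceᵖ (π₂ (π₁ (π₂ (π₁ fstᵖ)))) (π₂ sndᵖ) ⟩
      sndᵖ (π₁ fstᵖ) var small-advance₂))
  where
  -- Whatever the argument, each coordinate is an entry of a given row or the default 0, so the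
  -- input size bounds it.
  small-advance₂ : ∀ (x : ⟦ (squareTy ⊗ rowsTy ⊗ pairsTy) ⊗ (nat ⊗ nat) ⟧) (a : ⟦ nat ⊗ nat ⟧) →
    size (nat ⊗ nat) (advance₂ (proj₁ (proj₂ (proj₁ x))) a) ≤ size ((squareTy ⊗ rowsTy ⊗ pairsTy) ⊗ (nat ⊗ nat)) x
  small-advance₂ ((L , ((R , S) , (R′ , S′)) , seeds) , _) (x , y) = begin
    at 0 S (indexOf _≟_ x R) + at 0 S′ (indexOf _≟_ y R′)
        ≤⟨ +-mono-≤ (≤-trans (size-at S _) (m≤n+m _ (size permTy R))) (≤-trans (size-at S′ _) (m≤n+m _ (size permTy R′))) ⟩
    size rowsTy ((R , S) , (R′ , S′))                        ≤⟨ m≤m+n _ _ ⟩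
    size (rowsTy ⊗ pairsTy) (((R , S) , (R′ , S′)) , seeds)    ≤⟨ m≤n+m _ (size squareTy L) ⟩
    _ ≤⟨ m≤m+n _ _ ⟩
    _ ∎
    where open ≤-Reasoning

symbolListᵖ : PolyTime {squareTy ⊗ rowsTy ⊗ pairsTy} {permTy}
                (λ (L , ρs , seeds) → symbolList (length L) (orbits (length L) ρs seeds))
symbolListᵖ = mapᵖ (upToᵖ (π₁ fstᵖ)) (assocᵖ sndᵖ (π₂ fstᵖ)) ∘ᵖ ⟨ idᵖ , orbitsᵖ ⟩

columnListᵖ : {R R′ γ : ⟦ X ⟧ → List ℕ} →
  PolyTime {X} {permTy} R → PolyTime {X} {permTy} R′ → PolyTime {X} {permTy} γ →
  PolyTime {X} {permTy} (λ x → columnList (R x) (R′ x) (γ x))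
columnListᵖ p p′ q = mapᵖ p (indexOfᵖ _≟_ nat-eqᵖ (atᵖ zeroᵖ (q ∘ᵖ fstᵖ) sndᵖ) (p′ ∘ᵖ fstᵖ))

rowListᵖ : {L : ⟦ X ⟧ → List (List ℕ)} {β γ : ⟦ X ⟧ → List ℕ} →
  PolyTime {X} {squareTy} L → PolyTime {X} {permTy} β → PolyTime {X} {permTy} γ →
  PolyTime {X} {permTy} (λ x → rowList (L x) (β x) (γ x))
rowListᵖ l p q = mapᵖ l (indexOfᵖ (≡-dec _≟_) (list-eqᵖ nat-eqᵖ)
  (mapᵖ sndᵖ (atᵖ zeroᵖ (q ∘ᵖ fstᵖ ∘ᵖ fstᵖ) sndᵖ))
  (mapᵖ (l ∘ᵖ fstᵖ) (mapᵖ (p ∘ᵖ fstᵖ ∘ᵖ fstᵖ) (atᵖ zeroᵖ (π₂ fstᵖ) sndᵖ))))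

reconstructᵖ : PolyTime {squareTy ⊗ rowsTy ⊗ pairsTy} {isotopismTy}
                 (λ (L , ρs , seeds) → reconstruct L ρs seeds)
reconstructᵖ =
     ⟨ rowListᵖ (π₁ (π₁ fstᵖ)) sndᵖ (π₂ fstᵖ) , ⟨ sndᵖ , π₂ fstᵖ ⟩ ⟩
  ∘ᵖ ⟨ idᵖ , columnListᵖ (π₁ (π₁ (π₁ (π₂ fstᵖ)))) (π₁ (π₂ (π₁ (π₂ fstᵖ)))) sndᵖ ⟩
  ∘ᵖ ⟨ idᵖ , symbolListᵖ ⟩

candidateᵖ : PolyTime {squareTy ⊗ pairsTy} {isotopismTy} (λ (L , ps) → candidate L ps)
candidateᵖ = PolyTime-≗ split (caseᵖ (unconsᵖ ∘ᵖ sndᵖ) none (caseᵖ (unconsᵖ ∘ᵖ π₂ sndᵖ) none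
  (reconstructᵖ ∘ᵖ ⟨ L , ⟨ ⟨ ⟨ rowAt (π₁ r) , rowAt (π₁ s) ⟩ , ⟨ rowAt (π₂ r) , rowAt (π₂ s) ⟩ ⟩ , π₂ sndᵖ ⟩ ⟩)))
  where
  none : PolyTime {X} {isotopismTy} (λ _ → [] , [] , [])
  none = ⟨ nilᵖ , ⟨ nilᵖ , nilᵖ ⟩ ⟩

  E : Ty
  E = ((squareTy ⊗ pairsTy) ⊗ ((nat ⊗ nat) ⊗ pairsTy)) ⊗ ((nat ⊗ nat) ⊗ pairsTy)

  L : PolyTime {E} {squareTy} _
  L = π₁ (π₁ fstᵖ)

  r s : PolyTime {E} {nat ⊗ nat} _
  r = π₁ (π₂ fstᵖ)
  s = π₁ sndᵖ

  rowAt : {i : ⟦ E ⟧ → ℕ} → PolyTime {E} {nat} i →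
      PolyTime {E} {permTy} (λ e → at [] (proj₁ (proj₁ (proj₁ e))) (i e))
  rowAt = atᵖ nilᵖ L

  split : ∀ ((L , ps) : ⟦ squareTy ⊗ pairsTy ⟧) →
    [ (λ _ → [] , [] , [])
    , (λ (rr , ps′) → [ (λ _ → [] , [] , [])
                      , (λ (ss , seeds) → reconstruct L ((at [] L (proj₁ rr) , at [] L (proj₁ ss)) ,
                          (at [] L (proj₂ rr) , at [] L (proj₂ ss))) seeds)
                      ]′ (uncons′ ps′)) ]′ (uncons′ ps) ≡ candidate L ps
  split (L , [])          = refl
  split (L , _ ∷ [])      = refl
  split (L , _ ∷ _ ∷ _)   = refl

tuplesᵖ : {as : ⟦ X ⟧ → ⟦ list A ⟧} → ∀ k → PolyTime {X} {list A} as →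
    PolyTime {X} {list (list A)} (λ x → tuples k (as x))
tuplesᵖ zero    l = consᵖ ∘ᵖ ⟨ nilᵖ , nilᵖ ⟩
tuplesᵖ (suc k) l = cartesianProductWithᵖ l (tuplesᵖ k l) consᵖ

candidatesᵖ : ∀ k {L : ⟦ X ⟧ → List (List ℕ)} → PolyTime {X} {squareTy} L →
              PolyTime {X} {list isotopismTy} (λ x → candidates k (L x))
candidatesᵖ k l = mapᵖ (tuplesᵖ k (cartesianProductWithᵖ (upToᵖ l) (upToᵖ l) idᵖ)) (candidateᵖ ∘ᵖ ⟨ l ∘ᵖ fstᵖ , sndᵖ ⟩)

transposeᵖ : {L : ⟦ X ⟧ → List (List ℕ)} → PolyTime {X} {squareTy} L →
             PolyTime {X} {squareTy} (λ x → transpose′ (L x))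
transposeᵖ l = mapᵖ (upToᵖ l) (mapᵖ (l ∘ᵖ fstᵖ) (atᵖ zeroᵖ sndᵖ (π₂ fstᵖ)))

isPermutationᵖ : {xs : ⟦ X ⟧ → List ℕ} {L : ⟦ X ⟧ → List (List ℕ)} →
                 PolyTime {X} {squareTy} L → PolyTime {X} {permTy} xs →
                 PolyBool {X} (λ x → does (isPermutation? (length (L x)) (xs x)))
isPermutationᵖ l p = ∧ᵖ (nat-eqᵖ ∘ᵖ ⟨ lengthᵖ p , lengthᵖ l ⟩)
  (all?ᵖ (upToᵖ l) (any?ᵖ (p ∘ᵖ fstᵖ) (nat-eqᵖ ∘ᵖ ⟨ π₂ fstᵖ , sndᵖ ⟩)))

isAutotopismᵖ : PolyBool {squareTy ⊗ isotopismTy} (λ x → does (isAutotopism? x))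
isAutotopismᵖ = ∧ᵖ (isPermutationᵖ fstᵖ (π₁ sndᵖ)) (∧ᵖ (isPermutationᵖ fstᵖ (π₁ (π₂ sndᵖ)))
  (∧ᵖ (isPermutationᵖ fstᵖ (π₂ (π₂ sndᵖ)))
    (list-eqᵖ (list-eqᵖ nat-eqᵖ) ∘ᵖ
      ⟨ mapᵖ fstᵖ (mapᵖ sndᵖ (atᵖ zeroᵖ (π₂ (π₂ (sndᵖ ∘ᵖ fstᵖ ∘ᵖ fstᵖ))) sndᵖ))
      , mapᵖ (π₁ sndᵖ) (mapᵖ (π₁ (π₂ (sndᵖ ∘ᵖ fstᵖ)))
          (atᵖ zeroᵖ (atᵖ nilᵖ (π₁ (fstᵖ ∘ᵖ fstᵖ)) (π₂ fstᵖ)) sndᵖ)) ⟩)))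

autotopismsᵖ : ∀ k → PolyTime {squareTy} {list isotopismTy} (autotopisms k)
autotopismsᵖ k = deduplicateᵖ (pair-eqᵖ perm-eqᵖ (pair-eqᵖ perm-eqᵖ perm-eqᵖ))
  ∘ᵖ filterᵖ {P? = isAutotopism?}
       (++ᵖ (candidatesᵖ k idᵖ) (mapᵖ (candidatesᵖ k (transposeᵖ idᵖ))
           (⟨ π₁ (π₂ idᵖ) , ⟨ π₁ idᵖ , π₂ (π₂ idᵖ) ⟩ ⟩ ∘ᵖ sndᵖ)))
       isAutotopismᵖ
  where
  perm-eqᵖ : PolyEq permTy (≡-dec _≟_)
  perm-eqᵖ = list-eqᵖ nat-eqᵖ

-- Correctness of the program

at-tabulate : ∀ {A : Set} {n} (d : A) (f : Fin n → A) i → at d (tabulate f) (toℕ i) ≡ f i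
at-tabulate d f zero    = refl
at-tabulate d f (suc i) = at-tabulate d (f ∘ suc) i

tabulate-injective : ∀ {A : Set} {n} {f g : Fin n → A} → tabulate f ≡ tabulate g → ∀ i → f i ≡ g i
tabulate-injective {f = f} {g} eq i = begin
  f i                          ≡⟨ at-tabulate (f i) f i ⟨
  at (f i) (tabulate f) (toℕ i)  ≡⟨ cong (λ xs → at (f i) xs (toℕ i)) eq ⟩
  at (f i) (tabulate g) (toℕ i)  ≡⟨ at-tabulate (f i) g i ⟩
  g i                          ∎
  where open ≡-Reasoning

indexOf-tabulate : ∀ {A : Set} (_≟_ : DecidableEquality A) {n} (f : Fin n → A) → Injective _≡_ _≡_ f →
                   ∀ i → indexOf _≟_ (f i) (tabulate f) ≡ toℕ i
indexOf-tabulate _≟_ f inj zero rewrite dec-true (f zero ≟ f zero) refl = refl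
indexOf-tabulate _≟_ f inj (suc i)
  rewrite dec-false (f (suc i) ≟ f zero) (λ eq → Fin.0≢1+n (sym (inj eq)))
  = cong suc (indexOf-tabulate _≟_ (f ∘ suc) (Fin.suc-injective ∘ inj) i)

applyUpTo≡tabulate : ∀ {A : Set} (f : ℕ → A) n → applyUpTo f n ≡ tabulate {n = n} (f ∘ toℕ)
applyUpTo≡tabulate f zero    = refl
applyUpTo≡tabulate f (suc n) = cong (f 0 ∷_) (applyUpTo≡tabulate (f ∘ suc) n)

map-upTo-tabulate : ∀ {A B : Set} {n} (f : ℕ → B) (g : Fin n → A) →
                    map f (upTo (length (tabulate g))) ≡ tabulate {n = n} (f ∘ toℕ)
map-upTo-tabulate {n = n} f g =
  trans (cong (map f ∘ upTo) (length-tabulate g)) (trans (map-upTo f n) (applyUpTo≡tabulate f n))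

-- A missed value could be punched out, leaving an injection into a smaller finite set.
injective⇒surjective : ∀ {n} {f : Fin n → Fin n} → Injective _≡_ _≡_ f → ∀ y → ∃[ x ] f x ≡ y
injective⇒surjective {suc n} {f} inj y with Fin.any? (λ x → f x Fin.≟ y)
... | yes hit = hit
... | no miss = contradiction
  (Fin.injective⇒≤ {f = λ x → punchOut {i = y} {j = f x} (λ eq → miss (x , sym eq))}
    (λ {x} {x′} eq → inj (Fin.punchOut-injective (λ eq → miss (x , sym eq)) (λ eq → miss (x′ , sym eq)) eq)))
  1+n≰n

encodePerm-isPermutation : ∀ {n} (π : Permutation′ n) → IsPermutation n (encodePerm π)
encodePerm-isPermutation {n} π = length-tabulate (toℕ ∘ (π ⟨$⟩ʳ_))
  , subst (All (_∈ encodePerm π)) (sym (applyUpTo≡tabulate id n))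
      (All.tabulate⁺ (λ i → subst (λ j → toℕ j ∈ encodePerm π) (inverseʳ π)
          (∈-tabulate⁺ {f = toℕ ∘ (π ⟨$⟩ʳ_)} (π ⟨$⟩ˡ i))))

-- Sending a number to a position where it occurs is injective, hence by the pigeonhole principle
-- bijective; the permutation sought is the inverse.
isPermutation-encodePerm : ∀ {n} xs → IsPermutation n xs → ∃[ π ] encodePerm {n} π ≡ xs
isPermutation-encodePerm xs (refl , occur) = π , trans (tabulate-cong toℕ∘value≗lookup) (tabulate-lookup xs)
  where
  n = length xs

  occurs : ∀ i → toℕ i ∈ xs
  occurs = All.tabulate⁻ (subst (All (_∈ xs)) (applyUpTo≡tabulate id n) occur)

  position : Fin n → Fin n
  position i = Any.index (occurs i)

  lookup-position : ∀ i → toℕ i ≡ lookup xs (position i)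
  lookup-position i = Any.lookup-index (occurs i)

  position-injective : Injective _≡_ _≡_ position
  position-injective {i} {j} eq = Fin.toℕ-injective
    (trans (lookup-position i) (trans (cong (lookup xs) eq) (sym (lookup-position j))))

  value : Fin n → Fin n
  value j = proj₁ (injective⇒surjective position-injective j)

  position-value : ∀ j → position (value j) ≡ j
  position-value j = proj₂ (injective⇒surjective position-injective j)

  π : Permutation′ n
  π = permutation value position (λ i → position-injective (position-value (position i))) position-value

  toℕ∘value≗lookup : ∀ j → toℕ (value j) ≡ lookup xs j
  toℕ∘value≗lookup j = trans (lookup-position (value j)) (cong (lookup xs) (position-value j))

-- Squares and autotopisms in encoded form

transposeᴸ : ∀ {n} → LatinSquare n → LatinSquare n
transposeᴸ L = record
  { entry       = λ i j → entry L j i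
  ; row-perm    = column-perm L
  ; column-perm = row-perm L
  }

transposeᴬ : ∀ {n} {L : LatinSquare n} → Autotopism L → Autotopism (transposeᴸ L)
transposeᴬ (isotopism α β γ , p) = isotopism β α γ , λ i j → p j i

transpose′-encodeSquare : ∀ {n} (L : LatinSquare n) → transpose′ (encodeSquare L) ≡ encodeSquare (transposeᴸ L)
transpose′-encodeSquare {n} L = begin
  transpose′ (encodeSquare L)
    ≡⟨ map-upTo-tabulate (λ j → map (λ R → at 0 R j) (encodeSquare L)) (λ i → tabulate (λ j → toℕ (entry L i j))) ⟩
  tabulate (λ (j : Fin n) → map (λ R → at 0 R (toℕ j)) (encodeSquare L))
    ≡⟨ tabulate-cong (λ j → trans (map-tabulate (λ i → tabulate (toℕ ∘ entry L i)) (λ R → at 0 R (toℕ j)))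
         (tabulate-cong (λ i → at-tabulate 0 (toℕ ∘ entry L i) j))) ⟩
  encodeSquare (transposeᴸ L) ∎
  where open ≡-Reasoning

-- Stated with the lists of n iterates that `orbits` generates, so that no notion of cycle enters
-- the correctness of the program.
Covers : ∀ {n} → Permutation′ n → List (Fin n) → Set
Covers {n} π cs = ∀ y → Any (λ c → y ∈ iterate (π ⟨$⟩ʳ_) c n) cs

module _ {n : ℕ} (L : LatinSquare n) where

  private
    M = encodeSquare L

    rowList-at : ∀ i → at [] M (toℕ i) ≡ tabulate (toℕ ∘ entry L i)
    rowList-at = at-tabulate [] (λ i → tabulate (toℕ ∘ entry L i))

    length-M : length M ≡ n
    length-M = length-tabulate (λ i → tabulate (toℕ ∘ entry L i))

    entry-rowinjective : ∀ i → Injective _≡_ _≡_ (toℕ ∘ entry L i)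
    entry-rowinjective i eq = proj₁ (row-perm L i) (Fin.toℕ-injective eq)

  permuted-rows : ∀ (γ : Permutation′ n) →
    map (map (at 0 (encodePerm γ))) M ≡ tabulate (λ i → tabulate (λ j → toℕ (γ ⟨$⟩ʳ entry L i j)))
  permuted-rows γ = trans (map-tabulate _ _) (tabulate-cong λ i → trans (map-tabulate _ _)
      (tabulate-cong λ j → at-tabulate 0 (toℕ ∘ (γ ⟨$⟩ʳ_)) (entry L i j)))

  permuted-row : ∀ (β : Permutation′ n) i →
    map (at 0 (tabulate (toℕ ∘ entry L i))) (encodePerm β) ≡ tabulate (λ j → toℕ (entry L i (β ⟨$⟩ʳ j)))
  permuted-row β i = trans (map-tabulate (toℕ ∘ (β ⟨$⟩ʳ_)) (at 0 (tabulate (toℕ ∘ entry L i))))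
    (tabulate-cong λ j → at-tabulate 0 (toℕ ∘ entry L i) (β ⟨$⟩ʳ j))

  reindexed-rows : ∀ (α β : Permutation′ n) →
    map (λ i → map (at 0 (at [] M i)) (encodePerm β)) (encodePerm α) ≡
    tabulate (λ i → tabulate (λ j → toℕ (entry L (α ⟨$⟩ʳ i) (β ⟨$⟩ʳ j))))
  reindexed-rows α β = trans (map-tabulate (toℕ ∘ (α ⟨$⟩ʳ_)) _) (tabulate-cong λ i →
    trans (cong (λ R → map (at 0 R) (encodePerm β)) (rowList-at (α ⟨$⟩ʳ i))) (permuted-row β (α ⟨$⟩ʳ i)))

  isAutotopism-sound : ∀ Θ → IsAutotopism (M , Θ) → ∃[ Θ′ ] encodeIsotopism (proj₁ {B = λ Θ → Θ Maps L To L} Θ′) ≡ Θ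
  isAutotopism-sound (α′ , β′ , γ′) (αp , βp , γp , eq)
    with α , refl ← isPermutation-encodePerm α′ (subst (λ m → IsPermutation m α′) length-M αp)
       | β , refl ← isPermutation-encodePerm β′ (subst (λ m → IsPermutation m β′) length-M βp)
       | γ , refl ← isPermutation-encodePerm γ′ (subst (λ m → IsPermutation m γ′) length-M γp)
    = (isotopism α β γ , λ i j → Fin.toℕ-injective (tabulate-injective (tabulate-injective (begin
        tabulate (λ i → tabulate (λ j → toℕ (entry L (α ⟨$⟩ʳ i) (β ⟨$⟩ʳ j))))  ≡⟨ reindexed-rows α β ⟨
        map (λ i → map (at 0 (at [] M i)) β′) α′                             ≡⟨ eq ⟨
        map (map (at 0 γ′)) M                                                ≡⟨ permuted-rows γ ⟩
        tabulate (λ i → tabulate (λ j → toℕ (γ ⟨$⟩ʳ entry L i j)))              ∎) i) j))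
    , refl
    where open ≡-Reasoning

  isAutotopism-complete : ∀ ((Θ , _) : Autotopism L) → IsAutotopism (M , encodeIsotopism Θ)
  isAutotopism-complete (isotopism α β γ , p) =
      perm α , perm β , perm γ , (begin
        map (map (at 0 (encodePerm γ))) M                                      ≡⟨ permuted-rows γ ⟩
        tabulate (λ i → tabulate (λ j → toℕ (γ ⟨$⟩ʳ entry L i j)))
            ≡⟨ tabulate-cong (λ i → tabulate-cong (λ j → cong toℕ (p i j))) ⟨
        tabulate (λ i → tabulate (λ j → toℕ (entry L (α ⟨$⟩ʳ i) (β ⟨$⟩ʳ j))))  ≡⟨ reindexed-rows α β ⟨
        map (λ i → map (at 0 (at [] M i)) (encodePerm β)) (encodePerm α)       ∎)
    where
    open ≡-Reasoning
    perm : ∀ π → IsPermutation (length M) (encodePerm π)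
    perm π = subst (λ m → IsPermutation m (encodePerm π)) (sym length-M) (encodePerm-isPermutation π)

  -- Reconstruction of an autotopism from its seeds

  graph : (Fin n → Fin n) → Fin n → ℕ × ℕ
  graph f x = toℕ x , toℕ (f x)

  -- A key may occur many times, since iterates wrap around short cycles and seeds may share a
  -- cycle. All entries lie on the graph of f, so the first one found is right.
  assoc-graph : ∀ f {x} xs → x ∈ xs → assoc (toℕ x) (map (graph f) xs) ≡ toℕ (f x)
  assoc-graph f {x} (y ∷ xs) x∈ with x Fin.≟ y
  ... | yes refl rewrite dec-true (toℕ x ≟ toℕ x) refl = refl
  ... | no x≢y rewrite dec-false (toℕ x ≟ toℕ y) (x≢y ∘ Fin.toℕ-injective) =
    assoc-graph f xs (Any.tail x≢y x∈)

  advance-encoded : ∀ r s x →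
    advance (tabulate (toℕ ∘ entry L r) , tabulate (toℕ ∘ entry L s)) (toℕ x) ≡ toℕ (relativeRow L r s ⟨$⟩ʳ x)
  advance-encoded r s x = begin
    at 0 S (indexOf _≟_ (toℕ x) R)
        ≡⟨ cong (λ y → at 0 S (indexOf _≟_ (toℕ y) R)) (inverseʳ (row L r)) ⟨
    at 0 S (indexOf _≟_ (toℕ (entry L r j)) R)
        ≡⟨ cong (at 0 S) (indexOf-tabulate _≟_ (toℕ ∘ entry L r) (entry-rowinjective r) j) ⟩
    at 0 S (toℕ j)                               ≡⟨ at-tabulate 0 (toℕ ∘ entry L s) j ⟩
    toℕ (entry L s j)                            ∎
    where
    open ≡-Reasoning
    R = tabulate (toℕ ∘ entry L r)
    S = tabulate (toℕ ∘ entry L s)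
    j = row L r ⟨$⟩ˡ x

  module _ (Θ : Autotopism L) (r s : Fin n) where

    private
      α = rows (proj₁ Θ)
      β = columns (proj₁ Θ)
      γ = symbols (proj₁ Θ)
      p = proj₂ Θ

      ρ ρ′ : Permutation′ n
      ρ  = relativeRow L r s
      ρ′ = relativeRow L (α ⟨$⟩ʳ r) (α ⟨$⟩ʳ s)

      -- Let j be the column in which row r holds x. Then γ(x) stands in row α(r) and column β(j),
      -- and row α(s) holds in that column the image under γ of the entry of row s in column j.
      conjugate : ∀ x → ρ′ ⟨$⟩ʳ (γ ⟨$⟩ʳ x) ≡ γ ⟨$⟩ʳ (ρ ⟨$⟩ʳ x)
      conjugate x = begin
        row L (α ⟨$⟩ʳ s) ⟨$⟩ʳ (row L (α ⟨$⟩ʳ r) ⟨$⟩ˡ (γ ⟨$⟩ʳ x))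
          ≡⟨ cong (λ y → row L (α ⟨$⟩ʳ s) ⟨$⟩ʳ (row L (α ⟨$⟩ʳ r) ⟨$⟩ˡ (γ ⟨$⟩ʳ y))) (inverseʳ (row L r)) ⟨
        row L (α ⟨$⟩ʳ s) ⟨$⟩ʳ (row L (α ⟨$⟩ʳ r) ⟨$⟩ˡ (γ ⟨$⟩ʳ entry L r j))
          ≡⟨ cong (λ y → row L (α ⟨$⟩ʳ s) ⟨$⟩ʳ (row L (α ⟨$⟩ʳ r) ⟨$⟩ˡ y)) (p r j) ⟨
        row L (α ⟨$⟩ʳ s) ⟨$⟩ʳ (row L (α ⟨$⟩ʳ r) ⟨$⟩ˡ (row L (α ⟨$⟩ʳ r) ⟨$⟩ʳ (β ⟨$⟩ʳ j)))
          ≡⟨ cong (row L (α ⟨$⟩ʳ s) ⟨$⟩ʳ_) (inverseˡ (row L (α ⟨$⟩ʳ r))) ⟩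
        entry L (α ⟨$⟩ʳ s) (β ⟨$⟩ʳ j)
          ≡⟨ p s j ⟩
        γ ⟨$⟩ʳ entry L s j ∎
        where
        open ≡-Reasoning
        j = row L r ⟨$⟩ˡ x

      R S R′ S′ : List ℕ
      R  = tabulate (toℕ ∘ entry L r)
      S  = tabulate (toℕ ∘ entry L s)
      R′ = tabulate (toℕ ∘ entry L (α ⟨$⟩ʳ r))
      S′ = tabulate (toℕ ∘ entry L (α ⟨$⟩ʳ s))

    iterate-graph : ∀ c m → iterate (advance₂ ((R , S) , (R′ , S′))) (graph (γ ⟨$⟩ʳ_) c) m
                          ≡ map (graph (γ ⟨$⟩ʳ_)) (iterate (ρ ⟨$⟩ʳ_) c m)
    iterate-graph c zero    = refl
    iterate-graph c (suc m) = cong (graph (γ ⟨$⟩ʳ_) c ∷_) (trans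
      (cong (λ q → iterate (advance₂ ((R , S) , (R′ , S′))) q m)
        (cong₂ _,_ (advance-encoded r s c) (trans (advance-encoded (α ⟨$⟩ʳ r) (α ⟨$⟩ʳ s) (γ ⟨$⟩ʳ c)) (cong toℕ (conjugate c)))))
      (iterate-graph (ρ ⟨$⟩ʳ c) m))

    orbits-graph : ∀ cs → orbits n ((R , S) , (R′ , S′)) (map (graph (γ ⟨$⟩ʳ_)) cs)
                        ≡ map (graph (γ ⟨$⟩ʳ_)) (concatMap (λ c → iterate (ρ ⟨$⟩ʳ_) c n) cs)
    orbits-graph []       = refl
    orbits-graph (c ∷ cs) = trans (cong₂ _++_ (iterate-graph c n) (orbits-graph cs))
      (sym (map-++ (graph (γ ⟨$⟩ʳ_)) (iterate (ρ ⟨$⟩ʳ_) c n) _))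

    symbolList-correct : ∀ cs → Covers ρ cs →
      symbolList n (orbits n ((R , S) , (R′ , S′)) (map (graph (γ ⟨$⟩ʳ_)) cs)) ≡ encodePerm γ
    symbolList-correct cs cover = begin
      map (λ x → assoc x (orbits n ((R , S) , (R′ , S′)) (map (graph (γ ⟨$⟩ʳ_)) cs))) (upTo n)
        ≡⟨ cong (λ t → map (λ x → assoc x t) (upTo n)) (orbits-graph cs) ⟩
      map (λ x → assoc x (map (graph (γ ⟨$⟩ʳ_)) xs)) (upTo n)
        ≡⟨ trans (map-upTo _ n) (applyUpTo≡tabulate _ n) ⟩
      tabulate (λ x → assoc (toℕ x) (map (graph (γ ⟨$⟩ʳ_)) xs))
        ≡⟨ tabulate-cong (λ x → assoc-graph (γ ⟨$⟩ʳ_) xs (∈-concatMap⁺ (λ c → iterate (ρ ⟨$⟩ʳ_) c n) (cover x))) ⟩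
      encodePerm γ ∎
      where
      open ≡-Reasoning
      xs = concatMap (λ c → iterate (ρ ⟨$⟩ʳ_) c n) cs

    columnList-correct : columnList R R′ (encodePerm γ) ≡ encodePerm β
    columnList-correct = trans (map-tabulate (toℕ ∘ entry L r) _) (tabulate-cong λ j → begin
      indexOf _≟_ (at 0 (encodePerm γ) (toℕ (entry L r j))) R′
        ≡⟨ cong (λ y → indexOf _≟_ y R′) (at-tabulate 0 (toℕ ∘ (γ ⟨$⟩ʳ_)) (entry L r j)) ⟩
      indexOf _≟_ (toℕ (γ ⟨$⟩ʳ entry L r j)) R′
        ≡⟨ cong (λ y → indexOf _≟_ (toℕ y) R′) (p r j) ⟨
      indexOf _≟_ (toℕ (entry L (α ⟨$⟩ʳ r) (β ⟨$⟩ʳ j))) R′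
        ≡⟨ indexOf-tabulate _≟_ (toℕ ∘ entry L (α ⟨$⟩ʳ r)) (entry-rowinjective (α ⟨$⟩ʳ r)) (β ⟨$⟩ʳ j) ⟩
      toℕ (β ⟨$⟩ʳ j) ∎)
      where open ≡-Reasoning

    rowList-correct : rowList M (encodePerm β) (encodePerm γ) ≡ encodePerm α
    rowList-correct = trans (map-tabulate (λ i → tabulate (toℕ ∘ entry L i)) _) (tabulate-cong λ i → begin
      indexOf (≡-dec _≟_) (map (at 0 (encodePerm γ)) (tabulate (toℕ ∘ entry L i)))
          (map (λ T → map (at 0 T) (encodePerm β)) M)
        ≡⟨ cong₂ (indexOf (≡-dec _≟_)) (image i) rows-reordered ⟩
      indexOf (≡-dec _≟_) (reordered (α ⟨$⟩ʳ i)) (tabulate reordered)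
        ≡⟨ indexOf-tabulate (≡-dec _≟_) reordered reordered-injective (α ⟨$⟩ʳ i) ⟩
      toℕ (α ⟨$⟩ʳ i) ∎)
      where
      open ≡-Reasoning

      reordered : Fin n → List ℕ
      reordered i = tabulate (λ j → toℕ (entry L i (β ⟨$⟩ʳ j)))

      -- A single column already tells the rows apart; r serves here as an arbitrary column index.
      reordered-injective : Injective _≡_ _≡_ reordered
      reordered-injective eq = proj₁ (column-perm L (β ⟨$⟩ʳ r)) (Fin.toℕ-injective (tabulate-injective eq r))

      image : ∀ i → map (at 0 (encodePerm γ)) (tabulate (toℕ ∘ entry L i)) ≡ reordered (α ⟨$⟩ʳ i)
      image i = trans (map-tabulate (toℕ ∘ entry L i) _) (tabulate-cong λ j →
        trans (at-tabulate 0 (toℕ ∘ (γ ⟨$⟩ʳ_)) (entry L i j)) (cong toℕ (sym (p i j))))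

      rows-reordered : map (λ T → map (at 0 T) (encodePerm β)) M ≡ tabulate reordered
      rows-reordered = trans (map-tabulate (λ i → tabulate (toℕ ∘ entry L i)) _) (tabulate-cong (permuted-row β))

    seeds : List (Fin n) → List (ℕ × ℕ)
    seeds cs = graph (α ⟨$⟩ʳ_) r ∷ graph (α ⟨$⟩ʳ_) s ∷ map (graph (γ ⟨$⟩ʳ_)) cs

    candidate-correct : ∀ cs → Covers ρ cs → candidate M (seeds cs) ≡ encodeIsotopism (proj₁ Θ)
    candidate-correct cs cover
      rewrite rowList-at r | rowList-at s | rowList-at (α ⟨$⟩ʳ r) | rowList-at (α ⟨$⟩ʳ s) | length-M
            | symbolList-correct cs cover | columnList-correct | rowList-correct = refl

    ∈-candidates : ∀ k cs → length cs ≡ k → Covers ρ cs → encodeIsotopism (proj₁ Θ) ∈ candidates (2 + k) M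
    ∈-candidates k cs len cover rewrite length-M = subst (_∈ map (candidate M) (tuples (2 + k) (cartesianProduct (upTo n) (upTo n)))) (candidate-correct cs cover)
      (∈-map⁺ (candidate M) (∈-tuples (2 + k) (seeds cs) (cong (2 +_) (trans (length-map (graph (γ ⟨$⟩ʳ_)) cs) len))
        (∈-grid (α ⟨$⟩ʳ_) r ∷ ∈-grid (α ⟨$⟩ʳ_) s ∷ All.map⁺ (All.universal (∈-grid (γ ⟨$⟩ʳ_)) cs))))
      where
      ∈-tuples : ∀ {A : Set} {as : List A} k xs → length xs ≡ k → All (_∈ as) xs → xs ∈ tuples k as
      ∈-tuples zero    []       refl []         = here refl
      ∈-tuples (suc k) (x ∷ xs) len (x∈ ∷ xs∈) = ∈-cartesianProductWith⁺ _∷_ x∈ (∈-tuples k xs (suc-injective len) xs∈)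

      ∈-grid : ∀ (f : Fin n → Fin n) x → graph f x ∈ cartesianProduct (upTo n) (upTo n)
      ∈-grid f x = ∈-cartesianProduct⁺ (∈-upTo⁺ (Fin.toℕ<n x)) (∈-upTo⁺ (Fin.toℕ<n (f x)))

-- Cycles

-- One symbol is singled out because its image is free, while each other image avoids it.
-- Distinctness from this one symbol is exactly what turns the remaining factors n into n-1.
record Representatives {n} (k : ℕ) (π : Permutation′ n) : Set where
  field
    first    : Fin n
    others   : List (Fin n)
    distinct : All (first ≢_) others
    few      : suc (length others) ≤ k
    covers   : Covers π (first ∷ others)

open Representatives

∈-iterate-≤ : ∀ {A : Set} (f : A → A) {x y m n} → m ≤ n → y ∈ iterate f x m → y ∈ iterate f x n
∈-iterate-≤ f (s≤s m≤n) (here y≡x)  = here y≡x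
∈-iterate-≤ f (s≤s m≤n) (there y∈) = there (∈-iterate-≤ f m≤n y∈)

-- A cycle closes at its own head, but its tail does not; the end point z is a separate variable so
-- that the induction goes through.
chain-iterate : ∀ {A : Set} (f : A → A) {x z} xs → map f (x ∷ xs) ≡ xs ∷ʳ z → x ∷ xs ≡ iterate f x (suc (length xs))
chain-iterate f {x} []       eq = refl
chain-iterate f {x} (y ∷ ys) eq = cong (x ∷_) (trans (chain-iterate f ys (∷-injectiveʳ eq))
  (cong (λ y → iterate f y (suc (length ys))) (sym (∷-injectiveˡ eq))))

module _ {n : ℕ} {π : Permutation′ n} where

  private
    head′ : ∀ {xs} → IsCycle π xs → Fin n
    head′ {x ∷ xs} _ = x

    heads : ∀ {css} → All (IsCycle π) css → List (Fin n)
    heads = All.reduce head′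

    length-heads : ∀ {css} (cyclic : All (IsCycle π) css) → length (heads cyclic) ≡ length css
    length-heads []       = refl
    length-heads (_ ∷ cs) = cong suc (length-heads cs)

    heads-distinct : ∀ {x css} (cyclic : All (IsCycle π) css) → All (x ≢_) (concat css) → All (x ≢_) (heads cyclic)
    heads-distinct                   []       _          = []
    heads-distinct {css = (_ ∷ xs) ∷ _} (_ ∷ cs) (x≢ ∷ x≢s) = x≢ ∷ heads-distinct cs (All.++⁻ʳ xs x≢s)

    -- No cycle is longer than the concatenation of all of them, so n iterates of its head run
    -- through it.
    heads-cover : ∀ {y css} (cyclic : All (IsCycle π) css) → length (concat css) ≤ n →
                  Any (y ∈_) css → Any (λ c → y ∈ iterate (π ⟨$⟩ʳ_) c n) (heads cyclic)
    heads-cover {y} {(x ∷ xs) ∷ css} (cycle ∷ _) short (here y∈) =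
      here (∈-iterate-≤ (π ⟨$⟩ʳ_) {x} {y} {suc (length xs)}
          (≤-trans (s≤s (m≤m+n (length xs) _)) (subst (_≤ n) (length-++ (x ∷ xs)) short))
        (subst (y ∈_) (chain-iterate (π ⟨$⟩ʳ_) xs cycle) y∈))
    heads-cover {css = xs ∷ css} (_ ∷ cs) short (there y∈) =
      there (heads-cover cs (≤-trans (m≤n+m _ (length xs)) (subst (_≤ n) (length-++ xs) short)) y∈)

  representatives : ∀ {k} → Fin n → HasAtMostCycles k π → Representatives k π
  representatives {k} i (λs , (record { cycles = css ; areCycle = cyclic ; partition = part } , lengths) , λs≤k) =
    select css cyclic covered unique css≤k
    where
    covered : ∀ y → Any (λ c → y ∈ iterate (π ⟨$⟩ʳ_) c n) (heads cyclic)
    covered y = heads-cover cyclic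
      (≤-reflexive (trans (↭-length part) (length-tabulate {n = n} id)))
      (∈-concat⁻ css (∈-resp-↭ (↭-sym part) (∈-allFin y)))

    unique : Uniqueₚ (concat css)
    unique = Permutationₛ.Unique-resp-↭ (setoid (Fin n)) (↭⇒↭ₛ (↭-sym part)) (Uniqueₚ.allFin⁺ n)

    css≤k : length css ≤ k
    css≤k = subst (_≤ k) (trans (sym (↭-length lengths)) (length-map length css)) λs≤k

    select : ∀ css (cyclic : All (IsCycle π) css) → Covers π (heads cyclic) →
             Uniqueₚ (concat css) → length css ≤ k → Representatives k π
    -- An empty decomposition would leave the given point i uncovered.
    select []               []       cover _          _     = contradiction (cover i) λ ()
    select ((x ∷ xs) ∷ css) (c ∷ cs) cover (x≢ ∷ _) css≤k = record
      { first    = x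
      ; others   = heads cs
      ; distinct = heads-distinct cs (All.++⁻ʳ xs x≢)
      ; few      = subst (λ l → suc l ≤ k) (sym (length-heads cs)) css≤k
      ; covers   = cover
      }

-- The list of representatives is padded to length k by an arbitrary symbol.
∈-candidates-row : ∀ {n k} (L : LatinSquare n) r s → Representatives k (relativeRow L r s) →
                   ((Θ , _) : Autotopism L) → encodeIsotopism Θ ∈ candidates (2 + k) (encodeSquare L)
∈-candidates-row {n} {k} L r s reps Θ = ∈-candidates L Θ r s k (cs ++ replicate (k ∸ length cs) r)
  (trans (length-++ cs) (trans (cong (length cs +_) (length-replicate (k ∸ length cs))) (m+[n∸m]≡n (few reps))))
  (λ y → Any.++⁺ˡ (covers reps y))
  where cs = first reps ∷ others reps

-- `relativeColumn L` unfolds to `relativeRow (transposeᴸ L)`, so the row case applies without any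
-- conversion of the representatives.
∈-candidates-column : ∀ {n k} (L : LatinSquare n) r s → Representatives k (relativeColumn L r s) →
                      ((Θ , _) : Autotopism L) → encodeIsotopism Θ ∈ map swap′ (candidates (2 + k) (transpose′ (encodeSquare L)))
∈-candidates-column {k = k} L r s reps Θ rewrite transpose′-encodeSquare L =
  ∈-map⁺ swap′ (∈-candidates-row {k = k} (transposeᴸ L) r s reps (transposeᴬ {L = L} Θ))

-- Soundness and completeness of the output list

𝔄-setoid : ∀ {n} → LatinSquare n → Setoid 0ℓ 0ℓ
𝔄-setoid L = Group.setoid (𝔄 L)

encodePerm-injective : ∀ {n} {π ρ : Permutation′ n} → encodePerm π ≡ encodePerm ρ → π Perm.≈ ρ
encodePerm-injective eq i = Fin.toℕ-injective (tabulate-injective eq i)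

encodeIsotopism-injective : ∀ {n} {Θ Φ : Isotopism n} → encodeIsotopism Θ ≡ encodeIsotopism Φ → Θ ≈ᵢ Φ
encodeIsotopism-injective {Θ = Θ} {Φ} eq = mk≈
  (encodePerm-injective {π = rows Θ} {rows Φ} (cong proj₁ eq))
  (encodePerm-injective {π = columns Θ} {columns Φ} (cong (proj₁ ∘ proj₂) eq))
  (encodePerm-injective {π = symbols Θ} {symbols Φ} (cong (proj₂ ∘ proj₂) eq))

encodeIsotopism-cong : ∀ {n} {Θ Φ : Isotopism n} → Θ ≈ᵢ Φ → encodeIsotopism Θ ≡ encodeIsotopism Φ
encodeIsotopism-cong (mk≈ a b c) = cong₂ _,_ (tabulate-cong (cong toℕ ∘ a))
  (cong₂ _,_ (tabulate-cong (cong toℕ ∘ b)) (tabulate-cong (cong toℕ ∘ c)))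

lists-autotopisms : ∀ {n} k (L : LatinSquare n) → Fin n → HasPairWithAtMostCycles k L →
                    IsListOfAutotopisms L (autotopisms (2 + k) (encodeSquare L))
lists-autotopisms {n} k L i few-cycles = Θs , enumerates , unique , out≡
  where
  M = encodeSquare L
  all-candidates = candidates (2 + k) M ++ map swap′ (candidates (2 + k) (transpose′ M))
  checked = filter (λ Θ → isAutotopism? (M , Θ)) all-candidates
  out = autotopisms (2 + k) M

  encode : Autotopism L → ⟦ isotopismTy ⟧
  encode (Θ , _) = encodeIsotopism Θ

  decoded : All (λ o → ∃[ Θ ] encode Θ ≡ o) out
  decoded = All.tabulate λ {o} o∈ → isAutotopism-sound L o
    (proj₂ (∈-filter⁻ (λ Θ → isAutotopism? (M , Θ)) {xs = all-candidates} (∈-deduplicate⁻ _≟ᵢ_ checked o∈)))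

  Θs : List (Autotopism L)
  Θs = All.reduce proj₁ decoded

  encode-reduce : ∀ {os} (ds : All (λ o → ∃[ Θ ] encode Θ ≡ o) os) → os ≡ map encode (All.reduce proj₁ ds)
  encode-reduce []              = refl
  encode-reduce ((_ , eq) ∷ ds) = cong₂ _∷_ (sym eq) (encode-reduce ds)

  out≡ : out ≡ map encode Θs
  out≡ = encode-reduce decoded

  ∈-all-candidates : HasPairWithAtMostCycles k L → ∀ Θ → encode Θ ∈ all-candidates
  ∈-all-candidates (inj₁ (r , s , _ , few)) Θ = ∈-++⁺ˡ (∈-candidates-row L r s (representatives {k = k} i few) Θ)
  ∈-all-candidates (inj₂ (r , s , _ , few)) Θ = ∈-++⁺ʳ (candidates (2 + k) M)
      (∈-candidates-column L r s (representatives {k = k} i few) Θ)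

  enumerates : Enumerates.IsEnumeration (𝔄-setoid L) Θs
  enumerates Θ = Any.map encodeIsotopism-injective (Any.map⁻ {f = encode} (subst (encode Θ ∈_) out≡
    (∈-deduplicate⁺ _≟ᵢ_ (∈-filter⁺ (λ Θ → isAutotopism? (M , Θ)) (∈-all-candidates few-cycles Θ)
        (isAutotopism-complete L Θ)))))

  unique : UniqueSetoid.Unique (𝔄-setoid L) Θs
  unique = Unique.map⁻ (𝔄-setoid L) (setoid ⟦ isotopismTy ⟧) encodeIsotopism-cong
    (subst Uniqueₚ out≡ (Deduplicate.deduplicate-! _≟ᵢ_ checked))

module _ {S : Setoid 0ℓ 0ℓ} where
  open Setoid S using (_≈_) renaming (Carrier to Elem; refl to ≈-refl; sym to ≈-sym; trans to ≈-trans)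

  lookup-injective : ∀ {xs} → UniqueSetoid.Unique S xs → ∀ {i j} → lookup xs i ≈ lookup xs j → i ≡ j
  lookup-injective (_ ∷ _)  {zero}  {zero}  _  = refl
  lookup-injective {x ∷ xs} (x≉ ∷ _) {zero}  {suc j} eq = contradiction eq (All.lookup x≉ (∈-lookup j))
  lookup-injective {x ∷ xs} (x≉ ∷ _) {suc i} {zero}  eq = contradiction (≈-sym eq) (All.lookup x≉ (∈-lookup i))
  lookup-injective (_ ∷ xs!) {suc i} {suc j} eq = cong suc (lookup-injective xs! eq)

  enumeration⇒inverse : ∀ {xs} → Enumerates.IsEnumeration S xs → UniqueSetoid.Unique S xs →
                        Inverse (setoid (Fin (length xs))) S
  enumeration⇒inverse {xs} enum xs! = record
    { to        = lookup xs
    ; from      = index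
    ; to-cong   = λ { refl → ≈-refl }
    ; from-cong = λ x≈y → lookup-injective xs! (≈-trans (≈-sym (lookup-index _)) (≈-trans x≈y (lookup-index _)))
    ; inverse   = (λ { refl → ≈-sym (lookup-index _) })
                , (λ x≈ → lookup-injective xs! (≈-trans (≈-sym (lookup-index _)) x≈))
    }
    where
    index : Elem → Fin (length xs)
    index x = Any.index (enum x)

    lookup-index : ∀ x → x ≈ lookup xs (index x)
    lookup-index x = Any.lookup-index (enum x)

-- The bound on the order

-- Bounding families of pairwise different autotopisms instead of the order lets the bound pass from
-- the transposed square by exchanging two components.
Independent : ∀ {n m} (L : LatinSquare n) → (Fin m → Autotopism L) → Set
Independent L Θ = ∀ {i j} → proj₁ (Θ i) ≈ᵢ proj₁ (Θ j) → i ≡ j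

-- The pivots i and i′ will be images under two autotopisms, known to agree only once the first
-- coordinates have been compared.
punchOut-cancel : ∀ {n} {i i′ j j′ : Fin (suc n)} (i≢j : i ≢ j) (i′≢j′ : i′ ≢ j′) →
                  i ≡ i′ → punchOut i≢j ≡ punchOut i′≢j′ → j ≡ j′
punchOut-cancel i≢j i≢j′ refl eq = Fin.punchOut-injective i≢j i≢j′ eq

permutation-≢ : ∀ {n} (π : Permutation′ n) {i j} → i ≢ j → π ⟨$⟩ʳ i ≢ π ⟨$⟩ʳ j
permutation-≢ π i≢j eq = i≢j (trans (sym (inverseˡ π)) (trans (cong (π ⟨$⟩ˡ_) eq) (inverseˡ π)))

module _ {p m k : ℕ} (L : LatinSquare (suc p)) {r s : Fin (suc p)} (r≢s : r ≢ s)
         (reps : Representatives k (relativeRow L r s)) (Θ : Fin m → Autotopism L) (independent : Independent L Θ) where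

  private
    n = suc p
    c  = first reps
    cs = others reps
    ℓ  = length cs

    α γ : Fin m → Permutation′ n
    α i = rows (proj₁ (Θ i))
    γ i = symbols (proj₁ (Θ i))

    αr≢αs : ∀ i → α i ⟨$⟩ʳ r ≢ α i ⟨$⟩ʳ s
    αr≢αs i = permutation-≢ (α i) r≢s

    γc≢γ : ∀ i t → γ i ⟨$⟩ʳ c ≢ γ i ⟨$⟩ʳ lookup cs t
    γc≢γ i t = permutation-≢ (γ i) (All.lookup (distinct reps) (∈-lookup t))

    others-image : Fin m → Fin ℓ → Fin p
    others-image i t = punchOut (γc≢γ i t)

    rows-image : Fin m → Fin (n * p)
    rows-image i = combine (α i ⟨$⟩ʳ r) (punchOut (αr≢αs i))

    symbols-image : Fin m → Fin (n * p ^ ℓ)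
    symbols-image i = combine (γ i ⟨$⟩ʳ c) (funToFin (others-image i))

    -- The coordinates are α(r), then α(s) among the p = n-1 values other than α(r), then γ(c), then
    -- the remaining ℓ images among the p values other than γ(c).
    image : Fin m → Fin (n * p * (n * p ^ ℓ))
    image i = combine (rows-image i) (symbols-image i)

    -- The image determines the seeds, and `candidate` computes the encoding of the autotopism from
    -- the seeds.
    image-injective : Injective _≡_ _≡_ image
    image-injective {i} {j} eq = independent (encodeIsotopism-injective (trans
      (sym (candidate-correct L (Θ i) r s (c ∷ cs) (covers reps)))
      (trans (cong (candidate (encodeSquare L)) seeds≡)
        (candidate-correct L (Θ j) r s (c ∷ cs) (covers reps)))))
      where
      rows≡    = Fin.combine-injectiveˡ (rows-image i) (symbols-image i) (rows-image j) (symbols-image j) eq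
      symbols≡ = Fin.combine-injectiveʳ (rows-image i) (symbols-image i) (rows-image j) (symbols-image j) eq

      r≡ : α i ⟨$⟩ʳ r ≡ α j ⟨$⟩ʳ r
      r≡ = Fin.combine-injectiveˡ _ (punchOut (αr≢αs i)) _ (punchOut (αr≢αs j)) rows≡

      s≡ : α i ⟨$⟩ʳ s ≡ α j ⟨$⟩ʳ s
      s≡ = punchOut-cancel (αr≢αs i) (αr≢αs j) r≡
        (Fin.combine-injectiveʳ (α i ⟨$⟩ʳ r) _ (α j ⟨$⟩ʳ r) _ rows≡)

      c≡ : γ i ⟨$⟩ʳ c ≡ γ j ⟨$⟩ʳ c
      c≡ = Fin.combine-injectiveˡ _ (funToFin (others-image i)) _ (funToFin (others-image j)) symbols≡

      others≡ : ∀ t → γ i ⟨$⟩ʳ lookup cs t ≡ γ j ⟨$⟩ʳ lookup cs t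
      others≡ t = punchOut-cancel (γc≢γ i t) (γc≢γ j t) c≡ (begin
        others-image i t                       ≡⟨ Fin.finToFun-funToFin (others-image i) t ⟨
        finToFun (funToFin (others-image i)) t ≡⟨ cong (λ x → finToFun x t)
            (Fin.combine-injectiveʳ (γ i ⟨$⟩ʳ c) (funToFin (others-image i)) (γ j ⟨$⟩ʳ c) _ symbols≡) ⟩
        finToFun (funToFin (others-image j)) t ≡⟨ Fin.finToFun-funToFin (others-image j) t ⟩
        others-image j t                       ∎)
        where open ≡-Reasoning

      seeds≡ : seeds L (Θ i) r s (c ∷ cs) ≡ seeds L (Θ j) r s (c ∷ cs)
      seeds≡ = cong₂ (λ x ys → (toℕ r , toℕ x) ∷ ys) r≡
        (cong₂ (λ x ys → (toℕ s , toℕ x) ∷ ys) s≡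
          (cong₂ (λ x ys → (toℕ c , toℕ x) ∷ ys) c≡
            (All-map-cong (All.tabulate λ x∈ → subst (λ x → γ i ⟨$⟩ʳ x ≡ γ j ⟨$⟩ʳ x)
               (sym (Any.lookup-index x∈)) (others≡ (Any.index x∈))))))
        where
        All-map-cong : ∀ {xs} → All (λ x → γ i ⟨$⟩ʳ x ≡ γ j ⟨$⟩ʳ x) xs →
                       map (graph L (γ i ⟨$⟩ʳ_)) xs ≡ map (graph L (γ j ⟨$⟩ʳ_)) xs
        All-map-cong []         = refl
        All-map-cong (eq ∷ eqs) = cong₂ _∷_ (cong (λ y → _ , toℕ y) eq) (All-map-cong eqs)

  independent⇒few : m ≤ n ^ 2 * p ^ k
  independent⇒few = begin
    m                          ≤⟨ Fin.injective⇒≤ image-injective ⟩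
    n * p * (n * p ^ ℓ)        ≡⟨ [m*n]*[o*p]≡[m*o]*[n*p] n p n (p ^ ℓ) ⟩
    n * n * p ^ suc ℓ          ≡⟨ cong (λ x → n * x * p ^ suc ℓ) (*-identityʳ n) ⟨
    -- Of the suc ℓ factors p, one comes from α(s) and ℓ from the symbols other than c; there are
    -- suc ℓ representatives, hence at most k.
    n ^ 2 * p ^ suc ℓ          ≤⟨ *-monoʳ-≤ (n ^ 2) (p^-mono r≢s (few reps)) ⟩
    n ^ 2 * p ^ k              ∎
    where
    open ≤-Reasoning
    -- Monotonicity in the exponent fails for base 0, where 0^0 = 1. Two distinct rows force p to be
    -- positive.
    p^-mono : ∀ {p} {r s : Fin (suc p)} {a b} → r ≢ s → a ≤ b → p ^ a ≤ p ^ b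
    p^-mono {zero}  {zero} {zero} r≢s _ = contradiction refl r≢s
    p^-mono {suc p} _ a≤b = ^-monoʳ-≤ (suc p) a≤b

order-bound : ∀ {n m k} (L : LatinSquare n) → HasPairWithAtMostCycles k L →
              (Θ : Fin m → Autotopism L) → Independent L Θ → m ≤ n ^ 2 * (n ∸ 1) ^ k
order-bound {suc p} L (inj₁ (r , s , r≢s , cycles)) Θ independent =
  independent⇒few L r≢s (representatives r cycles) Θ independent
order-bound {suc p} L (inj₂ (r , s , r≢s , cycles)) Θ independent =
  independent⇒few (transposeᴸ L) r≢s (representatives r cycles) (transposeᴬ {L = L} ∘ Θ)
    (λ (mk≈ a b c) → independent (mk≈ b a c))

point : ∀ {n k} (L : LatinSquare n) → HasPairWithAtMostCycles k L → Fin n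
point _ (inj₁ (r , _)) = r
point _ (inj₂ (r , _)) = r

-- From input size to the order n, and the theorem

size-encodeSquare : ∀ {n} (L : LatinSquare n) → size squareTy (encodeSquare L) ≤ n * suc (n * suc n)
size-encodeSquare {n} L = size-tabulate (λ i → tabulate (toℕ ∘ entry L i))
  λ i → size-tabulate (toℕ ∘ entry L i) λ j → <⇒≤ (Fin.toℕ<n (entry L i j))
  where
  size-tabulate : ∀ {n M} (f : Fin n → ⟦ A ⟧) → (∀ i → size A (f i) ≤ M) → size (list A) (tabulate f) ≤ n * suc M
  size-tabulate {A} {M = M} f f≤ = subst (λ m → size (list A) (tabulate f) ≤ m * suc M) (length-tabulate f)
      (size-list (tabulate f) (All.tabulate⁺ f≤))

polyTime⇒computable : ∀ {Q : ∀ {n} → LatinSquare n → Set} {f} → PolyTime {squareTy} {list isotopismTy} f →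
  (∀ {n} (L : LatinSquare n) → Q L → IsListOfAutotopisms L (f (encodeSquare L))) →
  AutotopyGroupComputableInPolynomialTimeOn Q
polyTime⇒computable P correct =
  -- The inner polynomial n(1 + n(1 + n)) is the bound of `size-encodeSquare`; composing with it
  -- expresses the running time in n.
  let c , d , bound = polynomially-bounded (time P ⊡ (var ⊠ (con 1 ⊞ var ⊠ (con 1 ⊞ var))))
  in code P , c , d , λ n L q →
      let m , e , m≤ = run P [] (encodeSquare L)
      in _ , m , e , correct L q
       , ≤-trans m≤ (≤-trans (eval-mono (time P) (size-encodeSquare L)) (bound n))
  where open PolyTime

theorem3 : (k : ℕ) → 1 ≤ k →
    (∀ (n : ℕ) (L : LatinSquare n) → Reduced L → HasPairWithAtMostCycles k L →
    ∃[ order ] HasOrder (𝔄 L) order × order ≤ n ^ 2 * (n ∸ 1) ^ k)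
    × AutotopyGroupComputableInPolynomialTimeOn (λ L → Reduced L × HasPairWithAtMostCycles k L)
theorem3 k 1≤k =
    (λ n L _ few-cycles →
      let Θs , enumerates , unique , _ = lists-autotopisms k L (point L few-cycles) few-cycles
      in length Θs , enumeration⇒inverse {S = 𝔄-setoid L} enumerates unique
       , order-bound L few-cycles (lookup Θs) (lookup-injective {S = 𝔄-setoid L} unique))
  , polyTime⇒computable (autotopismsᵖ (2 + k))
      λ L (_ , few-cycles) → lists-autotopisms k L (point L few-cycles) few-cycles
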